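{- Let $\alpha>0$, let $G$ be a weighted multigraph and let $i,j$ be two vertices of $G$. The forest distance $d_{ij}$ is equal to the probability of choosing an unsuccessful connection between $i$ and $j$ in the following model of connecting $i$ and $j$: (1) Choose one of the two vertices, $i$ or $j$, with probability $1/2$ each. (2) Choose a spanning rooted forest of $G_\alpha$ at random (independently of step (1)), the probability of choosing the forest $F$ being $$p(F)=\frac{\varepsilon(F)}{\sum_{F'\in\mathcal F(G_\alpha)}\varepsilon(F')}.$$ (3) If the forest chosen in step (2) is an unsuccessful connection from the vertex chosen in step (1) to the remaining vertex of the pair $(i,j)$, then we say that an unsuccessful connection between $i$ and $j$ is chosen.
   Context: A weighted multigraph $G$ has finite vertex set $V(G)=\{1,\ldots,n\}$; multiple edges are allowed, loops are not, and all edge weights are strictly positive. Its Laplacian matrix $L=L(G)=(\ell_{ij})$ is given by: for $j\ne i$, $\ell_{ij}$ is minus the sum of the weights of all edges with terminal vertices $i$ and $j$; and $\ell_{ii}=-\sum_{j\neq i}\ell_{ij}$. For a fixed parameter $\alpha>0$, the relative forest accessibility matrix is $Q=(q_{ij})=(I+\alpha L)^{ -1}$, and the forest distance is $d_{ij}=\frac12(q_{ii}+q_{jj}-q_{ij}-q_{ji})$. $G_\alpha$ denotes the weighted multigraph obtained from $G$ by multiplying the weights of all its edges by $\alpha$. A rooted forest is an acyclic graph with one vertex marked as a root in each of its components; the components are rooted trees (a single vertex is allowed as a tree). $\mathcal F(G_\alpha)$ is the set of all spanning rooted forests of $G_\alpha$, i.e. rooted forests that are subgraphs of $G_\alpha$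 with vertex set all of $V(G)$ (parallel edges are regarded as distinct). The weight $\varepsilon(F)$ of a forest $F$ is the product of the weights of its edges (in $G_\alpha$), the empty product being $1$. An unsuccessful connection from $i$ to $j$ is a spanning rooted forest in which $i$ is a root of a tree and $j$ does not belong to this tree. -}

module Defs where

open import Algebra.Apartness.Bundles using (HeytingField)
open import Algebra.Bundles using (CommutativeRing)
open import Data.Bool.Base using (true; false; if_then_else_)
open import Data.Fin.Base using (Fin; zero; suc)
open import Data.Fin.Properties using (_≟_; any?; all?; injective⇒≤)
open import Data.Fin.Subset using (Subset; inside; outside; _∈_; ⊤) renaming (⊥ to ∅)
open import Data.Fin.Subset.Properties using (_∈?_; ∉⊥; ∈⊤)
open import Data.List.Base
  using (List; []; _∷_; _++_; map; filter; foldr; length; lookup; allFin;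
         cartesianProduct; cartesianProductWith)
open import Data.List.Properties using (length-map)
open import Data.List.Membership.Propositional using (lose) renaming (_∈_ to _∈ₗ_)
open import Data.List.Membership.Propositional.Properties
  using (∈-map⁺; ∈-++⁺ˡ; ∈-++⁺ʳ; ∈-filter⁺; ∈-filter⁻; ∈-allFin;
         ∈-cartesianProduct⁺; ∈-cartesianProductWith⁺)
open import Data.List.Relation.Unary.All as All using (All; []; _∷_)
open import Data.List.Relation.Unary.Any as Any using (Any; here; there)
open import Data.List.Relation.Unary.AllPairs using ([]; _∷_)
open import Data.List.Relation.Unary.Unique.Propositional using (Unique)
import Data.List.Relation.Unary.Unique.DecPropositional as DecUnique
open import Data.Nat.Base using (ℕ; zero; suc; z≤n; s≤s) renaming (_≤_ to _≤ℕ_)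
open import Data.Product.Base using (∃; ∃₂; _×_; _,_; proj₁; proj₂)
open import Data.Product.Properties using (≡-dec)
open import Data.Sum.Base using (_⊎_; inj₁; inj₂)
open import Data.Vec.Base as Vec using ()
open import Function.Base using (_∘_)
open import Level using (_⊔_) renaming (suc to lsuc)
open import Relation.Binary.Core using (Rel)
open import Relation.Binary.Structures using (IsStrictPartialOrder)
open import Relation.Binary.PropositionalEquality.Core as ≡ using (_≡_; _≢_; refl)
open import Relation.Nullary using (¬_; Dec; yes; no; contradiction; does)
open import Relation.Nullary.Decidable using (map′; _×-dec_; _⊎-dec_; _→-dec_; ¬?)
open import Relation.Unary using (Pred; Decidable)

------------------------------------------------------------------------
-- Ordered fields

-- The scalars.  ℝ is an instance (as is ℚ); neither excluded middle nor
-- decidability of the order is assumed, so constructive reals qualify too.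

record OrderedField c ℓ₁ ℓ₂ ℓ₃ : Set (lsuc (c ⊔ ℓ₁ ⊔ ℓ₂ ⊔ ℓ₃)) where
  infix 4 _<_
  field
    heytingField : HeytingField c ℓ₁ ℓ₂

  open HeytingField heytingField public

  field
    _<_                  : Rel Carrier ℓ₃
    isStrictPartialOrder : IsStrictPartialOrder _≈_ _<_
    <⇒#                  : ∀ {x y} → x < y → x # y
    #⇒<⊎>                : ∀ {x y} → x # y → x < y ⊎ y < x
    +-monoˡ-<            : ∀ z {x y} → x < y → x + z < y + z
    *-pos                : ∀ {x y} → 0# < x → 0# < y → 0# < x * y

  commutativeRing : CommutativeRing c ℓ₁
  commutativeRing = record { isCommutativeRing = isCommutativeRing }

------------------------------------------------------------------------
-- Walks, cycles and rooted forests in a multigraph given by the ends of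
-- its edges

module Combinatorics {n m : ℕ} (ends : Fin m → Fin n × Fin n) where

  Joins : Fin m → Fin n → Fin n → Set
  Joins e u v = ends e ≡ (u , v) ⊎ ends e ≡ (v , u)

  -- A walk using only edges of S, with the list of its successive
  -- (edge , vertex reached) pairs.
  data Walk (S : Subset m) : Fin n → List (Fin m × Fin n) → Fin n → Set where
    []   : ∀ {u} → Walk S u [] u
    step : ∀ {e u w ps v} → e ∈ S → Joins e u w → Walk S w ps v →
           Walk S u ((e , w) ∷ ps) v

  Connected : Subset m → Fin n → Fin n → Set
  Connected S u v = ∃ λ ps → Walk S u ps v

  -- Distinctness of the edges matters: e followed by e again is not a
  -- cycle, whereas two parallel edges do form one.
  IsCycle : Subset m → Fin n → List (Fin m × Fin n) → Set
  IsCycle S v ps =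
    ps ≢ [] × Walk S v ps v × Unique (map proj₁ ps) × Unique (map proj₂ ps)

  Acyclic : Subset m → Set
  Acyclic S = ¬ (∃₂ λ v ps → IsCycle S v ps)

  -- A spanning subgraph together with a set of marked vertices.
  RootedSubgraph : Set
  RootedSubgraph = Subset m × Subset n

  IsRootedForest : RootedSubgraph → Set
  IsRootedForest (S , R) =
    Acyclic S ×
    (∀ v → ∃ λ r → (r ∈ R × Connected S v r) ×
                   (∀ r′ → r′ ∈ R × Connected S v r′ → r′ ≡ r))

  UnsuccessfulConnection : Fin n → Fin n → RootedSubgraph → Set
  UnsuccessfulConnection i j (S , R) = i ∈ R × ¬ Connected S i j

  ----------------------------------------------------------------------
  -- Decidability

  joins? : ∀ e u v → Dec (Joins e u v)
  joins? e u v = ≡-dec _≟_ _≟_ (ends e) (u , v) ⊎-dec ≡-dec _≟_ _≟_ (ends e) (v , u)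

  walk? : ∀ S u ps v → Dec (Walk S u ps v)
  walk? S u [] v = map′ (λ { refl → [] }) (λ { [] → refl }) (u ≟ v)
  walk? S u ((e , w) ∷ ps) v =
    map′ (λ { (p , q , r) → step p q r }) (λ { (step p q r) → p , q , r })
         ((e ∈? S) ×-dec (joins? e u w ×-dec walk? S w ps v))

  isCycle? : ∀ S v ps → Dec (IsCycle S v ps)
  isCycle? S v ps =
    nonempty? ps ×-dec (walk? S v ps v ×-dec
      (DecUnique.unique? _≟_ (map proj₁ ps) ×-dec DecUnique.unique? _≟_ (map proj₂ ps)))
    where
    nonempty? : ∀ (qs : List (Fin m × Fin n)) → Dec (qs ≢ [])
    nonempty? []      = no λ ne → ne refl
    nonempty? (_ ∷ _) = yes λ ()

  listsUpTo : ∀ {A : Set} → List A → ℕ → List (List A)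
  listsUpTo as zero    = [] ∷ []
  listsUpTo as (suc k) = [] ∷ cartesianProductWith _∷_ as (listsUpTo as k)

  ∈-listsUpTo : ∀ {A : Set} {as : List A} → (∀ a → a ∈ₗ as) →
                ∀ {k} xs → length xs ≤ℕ k → xs ∈ₗ listsUpTo as k
  ∈-listsUpTo all {zero}  []       _       = here refl
  ∈-listsUpTo all {suc k} []       _       = here refl
  ∈-listsUpTo all {suc k} (x ∷ xs) (s≤s p) =
    there (∈-cartesianProductWith⁺ _∷_ (all x) (∈-listsUpTo all xs p))

  unique⇒length≤ : ∀ {k} {xs : List (Fin k)} → Unique xs → length xs ≤ℕ k
  unique⇒length≤ {k} uniq = injective⇒≤ (lookup-injective uniq)
    where
    lookup-All : ∀ {x : Fin k} {xs} → All (x ≢_) xs → ∀ i → x ≢ lookup xs i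
    lookup-All (p ∷ ps) zero    = p
    lookup-All (p ∷ ps) (suc i) = lookup-All ps i

    lookup-injective : ∀ {xs} → Unique xs → ∀ {i j} → lookup xs i ≡ lookup xs j → i ≡ j
    lookup-injective (_ ∷ _)  {zero}  {zero}  _  = refl
    lookup-injective (p ∷ _)  {zero}  {suc j} eq = contradiction eq (lookup-All p j)
    lookup-injective (p ∷ _)  {suc i} {zero}  eq = contradiction (≡.sym eq) (lookup-All p i)
    lookup-injective (_ ∷ us) {suc i} {suc j} eq = ≡.cong suc (lookup-injective us eq)

  acyclic? : ∀ S → Dec (Acyclic S)
  acyclic? S = ¬? (any? λ v → map′ Any.satisfied (bounded v) (Any.any? (isCycle? S v) candidates))
    where
    steps : List (Fin m × Fin n)
    steps = cartesianProduct (allFin m) (allFin n)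

    candidates : List (List (Fin m × Fin n))
    candidates = listsUpTo steps m

    bounded : ∀ v → ∃ (IsCycle S v) → Any (IsCycle S v) candidates
    bounded v (ps , c@(_ , _ , uniq , _)) =
      lose (∈-listsUpTo (λ { (e , w) → ∈-cartesianProduct⁺ (∈-allFin e) (∈-allFin w) }) ps
             (≡.subst (_≤ℕ m) (length-map proj₁ ps) (unique⇒length≤ uniq)))
           c

  -- Connectedness by adding one edge at a time, used only to decide Connected.
  Linked : List (Fin m) → Fin n → Fin n → Set
  Linked []       u v = u ≡ v
  Linked (e ∷ es) u v =
    Linked es u v ⊎
    (Linked es u (proj₁ (ends e)) × Linked es (proj₂ (ends e)) v) ⊎
    (Linked es u (proj₂ (ends e)) × Linked es (proj₁ (ends e)) v)

  linked? : ∀ es u v → Dec (Linked es u v)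
  linked? []       u v = u ≟ v
  linked? (e ∷ es) u v =
    linked? es u v ⊎-dec
    ((linked? es u (proj₁ (ends e)) ×-dec linked? es (proj₂ (ends e)) v) ⊎-dec
     (linked? es u (proj₂ (ends e)) ×-dec linked? es (proj₁ (ends e)) v))

  linked-refl : ∀ es {u} → Linked es u u
  linked-refl []       = refl
  linked-refl (_ ∷ es) = inj₁ (linked-refl es)

  linked-trans : ∀ es {u v w} → Linked es u v → Linked es v w → Linked es u w
  linked-trans []       p                    q                    = ≡.trans p q
  linked-trans (e ∷ es) (inj₁ p)             (inj₁ q)             = inj₁ (linked-trans es p q)
  linked-trans (e ∷ es) (inj₁ p)             (inj₂ (inj₁ (a , b))) = inj₂ (inj₁ (linked-trans es p a , b))
  linked-trans (e ∷ es) (inj₁ p)             (inj₂ (inj₂ (a , b))) = inj₂ (inj₂ (linked-trans es p a , b))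
  linked-trans (e ∷ es) (inj₂ (inj₁ (a , b))) (inj₁ q)             = inj₂ (inj₁ (a , linked-trans es b q))
  linked-trans (e ∷ es) (inj₂ (inj₂ (a , b))) (inj₁ q)             = inj₂ (inj₂ (a , linked-trans es b q))
  linked-trans (e ∷ es) (inj₂ (inj₁ (a , _))) (inj₂ (inj₁ (_ , d))) = inj₂ (inj₁ (a , d))
  linked-trans (e ∷ es) (inj₂ (inj₁ (a , _))) (inj₂ (inj₂ (_ , d))) = inj₁ (linked-trans es a d)
  linked-trans (e ∷ es) (inj₂ (inj₂ (a , _))) (inj₂ (inj₁ (_ , d))) = inj₁ (linked-trans es a d)
  linked-trans (e ∷ es) (inj₂ (inj₂ (a , _))) (inj₂ (inj₂ (_ , d))) = inj₂ (inj₂ (a , d))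

  linked-edge : ∀ {es e u v} → e ∈ₗ es → Joins e u v → Linked es u v
  linked-edge {_ ∷ es} (here refl) (inj₁ refl) = inj₂ (inj₁ (linked-refl es , linked-refl es))
  linked-edge {_ ∷ es} (here refl) (inj₂ refl) = inj₂ (inj₂ (linked-refl es , linked-refl es))
  linked-edge {_ ∷ es} (there e∈)  j           = inj₁ (linked-edge e∈ j)

  walk-trans : ∀ {S u v w ps qs} → Walk S u ps v → Walk S v qs w → Walk S u (ps ++ qs) w
  walk-trans []           q = q
  walk-trans (step a b p) q = step a b (walk-trans p q)

  linked⇒connected : ∀ {S} es → (∀ {e} → e ∈ₗ es → e ∈ S) →
                     ∀ {u v} → Linked es u v → Connected S u v
  linked⇒connected []       _  refl     = [] , []
  linked⇒connected (e ∷ es) ⊆S (inj₁ p) = linked⇒connected es (⊆S ∘ there) p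
  linked⇒connected (e ∷ es) ⊆S (inj₂ (inj₁ (p , q))) =
    _ , walk-trans (proj₂ (linked⇒connected es (⊆S ∘ there) p))
          (step (⊆S (here refl)) (inj₁ refl) (proj₂ (linked⇒connected es (⊆S ∘ there) q)))
  linked⇒connected (e ∷ es) ⊆S (inj₂ (inj₂ (p , q))) =
    _ , walk-trans (proj₂ (linked⇒connected es (⊆S ∘ there) p))
          (step (⊆S (here refl)) (inj₂ refl) (proj₂ (linked⇒connected es (⊆S ∘ there) q)))

  connected? : ∀ S u v → Dec (Connected S u v)
  connected? S u v =
    map′ (linked⇒connected es (λ e∈ → proj₂ (∈-filter⁻ (_∈? S) {xs = allFin m} e∈)))
         (λ { (_ , w) → complete w }) (linked? es u v)
    where
    es : List (Fin m)
    es = filter (_∈? S) (allFin m)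

    complete : ∀ {u ps v} → Walk S u ps v → Linked es u v
    complete []                     = linked-refl es
    complete (step {e = e} e∈ j w) =
      linked-trans es (linked-edge (∈-filter⁺ (_∈? S) (∈-allFin e) e∈) j) (complete w)

  isRootedForest? : Decidable IsRootedForest
  isRootedForest? (S , R) =
    acyclic? S ×-dec all? λ v → any? λ r →
      root? v r ×-dec all? λ r′ → root? v r′ →-dec (r′ ≟ r)
    where
    root? : ∀ v r → Dec (r ∈ R × Connected S v r)
    root? v r = (r ∈? R) ×-dec connected? S v r

  unsuccessfulConnection? : ∀ i j → Decidable (UnsuccessfulConnection i j)
  unsuccessfulConnection? i j (S , R) = (i ∈? R) ×-dec ¬? (connected? S i j)

  ----------------------------------------------------------------------
  -- Enumeration of the spanning rooted forests

  subsets : ∀ k → List (Subset k)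
  subsets zero    = Vec.[] ∷ []
  subsets (suc k) = map (outside Vec.∷_) (subsets k) ++ map (inside Vec.∷_) (subsets k)

  ∈-subsets : ∀ {k} (S : Subset k) → S ∈ₗ subsets k
  ∈-subsets Vec.[] = here refl
  ∈-subsets {suc k} (false Vec.∷ S) = ∈-++⁺ˡ (∈-map⁺ (outside Vec.∷_) (∈-subsets S))
  ∈-subsets {suc k} (true  Vec.∷ S) =
    ∈-++⁺ʳ (map (outside Vec.∷_) (subsets k)) (∈-map⁺ (inside Vec.∷_) (∈-subsets S))

  spanningRootedForests : List RootedSubgraph
  spanningRootedForests =
    filter isRootedForest? (cartesianProduct (subsets m) (subsets n))

  isRootedForest⇒∈ : ∀ {F} → IsRootedForest F → F ∈ₗ spanningRootedForests
  isRootedForest⇒∈ {S , R} =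
    ∈-filter⁺ isRootedForest? (∈-cartesianProduct⁺ (∈-subsets S) (∈-subsets R))

  edgeless-isRootedForest : IsRootedForest (∅ , ⊤)
  edgeless-isRootedForest = acyclic , λ v → v , (∈⊤ , [] , []) , λ r′ → λ where
      (_ , _ , [])            → refl
      (_ , _ , step e∈∅ _ _) → contradiction e∈∅ ∉⊥
    where
    acyclic : Acyclic ∅
    acyclic (_ , _ , ne , []            , _) = ne refl
    acyclic (_ , _ , _  , step e∈∅ _ _ , _) = ∉⊥ e∈∅

data Choice : Set where
  first second : Choice

------------------------------------------------------------------------
-- Forest distance and the random connection model

module ForestDistance {c ℓ₁ ℓ₂ ℓ₃} (K : OrderedField c ℓ₁ ℓ₂ ℓ₃) where

  open OrderedField K hiding (refl; zero)
  open CommutativeRing commutativeRing using (+-monoid; *-monoid)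
  open import Algebra.Properties.Monoid.Sum +-monoid using (sum; sum-syntax)
  open import Algebra.Properties.Monoid.Sum *-monoid using () renaming (sum to product)
  open import Algebra.Apartness.Properties.HeytingCommutativeRing
    (HeytingField.heytingCommutativeRing heytingField) using (1#0)
  open import Algebra.Properties.Ring (CommutativeRing.ring commutativeRing)
    using (-‿distribˡ-*; -‿involutive)
  module < = IsStrictPartialOrder isStrictPartialOrder

  ----------------------------------------------------------------------
  -- Inverses of positive scalars

  0<1 : 0# < 1#
  0<1 with #⇒<⊎> 1#0
  ... | inj₂ 0<1 = 0<1
  ... | inj₁ 1<0 = <.<-respʳ-≈ -1*-1≈1 (*-pos 0<-1 0<-1)
    where
    0<-1 : 0# < - 1#
    0<-1 = <.<-respˡ-≈ (-‿inverseʳ 1#) (<.<-respʳ-≈ (+-identityˡ (- 1#)) (+-monoˡ-< (- 1#) 1<0))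

    -1*-1≈1 : - 1# * - 1# ≈ 1#
    -1*-1≈1 = trans (sym (-‿distribˡ-* 1# (- 1#)))
                (trans (-‿cong (*-identityˡ (- 1#))) (-‿involutive 1#))

  +-pos : ∀ {x y} → 0# < x → 0# < y → 0# < x + y
  +-pos {x} {y} 0<x 0<y = <.trans 0<y (<.<-respˡ-≈ (+-identityˡ y) (+-monoˡ-< y 0<x))

  -- The library's inverse is that of x - 0#, which is ≈ to x.
  inverse : ∀ x → 0# < x → Carrier
  inverse x 0<x = proj₁ (#⇒invertible (#-sym (<⇒# 0<x)))

  ½ : Carrier
  ½ = inverse (1# + 1#) (+-pos 0<1 0<1)

  ----------------------------------------------------------------------
  -- Weighted multigraphs

  record WeightedMultigraph (n : ℕ) : Set (c ⊔ ℓ₃) where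
    field
      size       : ℕ
      ends       : Fin size → Fin n × Fin n
      loopless   : ∀ e → proj₁ (ends e) ≢ proj₂ (ends e)
      weight     : Fin size → Carrier
      weight-pos : ∀ e → 0# < weight e

    open Combinatorics ends public

  scale : ∀ {n} (α : Carrier) → 0# < α → WeightedMultigraph n → WeightedMultigraph n
  scale α 0<α G = record
    { size       = size
    ; ends       = ends
    ; loopless   = loopless
    ; weight     = λ e → α * weight e
    ; weight-pos = λ e → *-pos 0<α (weight-pos e)
    }
    where open WeightedMultigraph G

  ----------------------------------------------------------------------
  -- Matrices

  Matrix : ℕ → Set c
  Matrix n = Fin n → Fin n → Carrier

  I : ∀ {n} → Matrix n
  I i j = if does (i ≟ j) then 1# else 0#

  infixl 7 _⊗_
  _⊗_ : ∀ {n} → Matrix n → Matrix n → Matrix n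
  _⊗_ {n} A B i j = ∑[ k < n ] (A i k * B k j)

  infix 4 _≋_
  _≋_ : ∀ {n} → Matrix n → Matrix n → Set ℓ₁
  A ≋ B = ∀ i j → A i j ≈ B i j

  _IsInverseOf_ : ∀ {n} → Matrix n → Matrix n → Set ℓ₁
  B IsInverseOf A = (A ⊗ B ≋ I) × (B ⊗ A ≋ I)

  module _ {n : ℕ} (G : WeightedMultigraph n) where
    open WeightedMultigraph G

    totalWeightBetween : Fin n → Fin n → Carrier
    totalWeightBetween i j = ∑[ e < size ] (if does (joins? e i j) then weight e else 0#)

    -- Since off-diagonal entries are - totalWeightBetween, the diagonal
    -- entry below is minus the sum of the other entries of its row.
    laplacian : Matrix n
    laplacian i j = if does (i ≟ j) then - rowSum else offDiagonal j
      where
      offDiagonal : Fin n → Carrier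
      offDiagonal k = - totalWeightBetween i k

      rowSum : Carrier
      rowSum = ∑[ k < n ] (if does (i ≟ k) then 0# else offDiagonal k)

    IsForestAccessibilityMatrix : Carrier → Matrix n → Set ℓ₁
    IsForestAccessibilityMatrix α Q = Q IsInverseOf (λ i j → I i j + α * laplacian i j)

  forestDistance : ∀ {n} → Matrix n → Fin n → Fin n → Carrier
  forestDistance Q i j = ½ * (Q i i + Q j j - Q i j - Q j i)

  ----------------------------------------------------------------------
  -- Finite random experiments

  sumOver : ∀ {a} {A : Set a} → List A → (A → Carrier) → Carrier
  sumOver xs f = foldr (λ x s → f x + s) 0# xs

  record Experiment (Ω : Set) : Set c where
    field
      outcomes : List Ω
      mass     : Ω → Carrier

  independently : ∀ {Ω₁ Ω₂} → Experiment Ω₁ → Experiment Ω₂ → Experiment (Ω₁ × Ω₂)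
  independently X Y = record
    { outcomes = cartesianProduct X.outcomes Y.outcomes
    ; mass     = λ { (x , y) → X.mass x * Y.mass y }
    }
    where
    module X = Experiment X
    module Y = Experiment Y

  probability : ∀ {Ω p} {E : Pred Ω p} → Experiment Ω → Decidable E → Carrier
  probability X E? = sumOver (filter E? outcomes) mass
    where open Experiment X

  ----------------------------------------------------------------------
  -- Random spanning rooted forests

  module _ {n : ℕ} (G : WeightedMultigraph n) where
    open WeightedMultigraph G

    ε : RootedSubgraph → Carrier
    ε (S , R) = product (λ e → if does (e ∈? S) then weight e else 1#)

    totalForestWeight : Carrier
    totalForestWeight = sumOver spanningRootedForests ε

    product-pos : ∀ {k} (f : Fin k → Carrier) → (∀ e → 0# < f e) → 0# < product f
    product-pos {zero}  f 0<f = 0<1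
    product-pos {suc k} f 0<f = *-pos (0<f zero) (product-pos (f ∘ suc) (0<f ∘ suc))

    ε-pos : ∀ F → 0# < ε F
    ε-pos (S , R) = product-pos _ factor-pos
      where
      factor-pos : ∀ e → 0# < (if does (e ∈? S) then weight e else 1#)
      factor-pos e with does (e ∈? S)
      ... | true  = weight-pos e
      ... | false = 0<1

    sumOver-pos : ∀ {F Fs} → F ∈ₗ Fs → 0# < sumOver Fs ε
    sumOver-pos {Fs = F ∷ []}     _ = <.<-respʳ-≈ (sym (+-identityʳ (ε F))) (ε-pos F)
    sumOver-pos {Fs = F ∷ F′ ∷ Fs} _ = +-pos (ε-pos F) (sumOver-pos {F′} {F′ ∷ Fs} (here refl))

    totalForestWeight-pos : 0# < totalForestWeight
    totalForestWeight-pos = sumOver-pos (isRootedForest⇒∈ edgeless-isRootedForest)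

    randomForest : Experiment RootedSubgraph
    randomForest = record
      { outcomes = spanningRootedForests
      ; mass     = λ F → ε F * inverse totalForestWeight totalForestWeight-pos
      }

  ----------------------------------------------------------------------
  -- Connecting two vertices

  fairChoice : Experiment Choice
  fairChoice = record { outcomes = first ∷ second ∷ [] ; mass = λ _ → ½ }

  module _ {n : ℕ} (G : WeightedMultigraph n) (i j : Fin n) where
    open WeightedMultigraph G

    chosen remaining : Choice → Fin n
    chosen first     = i
    chosen second    = j
    remaining first  = j
    remaining second = i

    UnsuccessfulBetween : Choice × RootedSubgraph → Set
    UnsuccessfulBetween (x , F) = UnsuccessfulConnection (chosen x) (remaining x) F

    unsuccessfulBetween? : Decidable UnsuccessfulBetween
    unsuccessfulBetween? (x , F) = unsuccessfulConnection? (chosen x) (remaining x) F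

    probabilityUnsuccessful : Carrier
    probabilityUnsuccessful =
      probability (independently fairChoice (randomForest G)) unsuccessfulBetween?

{-# OPTIONS --safe #-}
module Submission where

open import Defs
open import Algebra.Bundles using (CommutativeMonoid; CommutativeRing)
open import Data.Bool.Base using (true; false; if_then_else_)
open import Data.Empty using (⊥-elim)
open import Data.Fin.Base using (Fin; zero; suc)
open import Data.Fin.Properties using (_≟_; suc-injective)
open import Data.Fin.Subset using (Subset; inside; outside; _∈_; _∉_; _⊆_) renaming (⊥ to ∅)
open import Data.Fin.Subset.Properties using (_∈?_)
open import Data.List.Base using (List; []; _∷_; _++_; map; filter; cartesianProduct)
open import Data.List.Membership.Propositional using () renaming (_∈_ to _∈ₗ_)
open import Data.List.Relation.Unary.All as All using (All; []; _∷_)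
open import Data.List.Relation.Unary.All.Properties using (¬Any⇒All¬)
open import Data.List.Relation.Unary.AllPairs using ([]; _∷_)
open import Data.List.Relation.Unary.Any as Any using (here; there)
open import Data.List.Relation.Unary.Unique.Propositional using (Unique)
open import Data.Nat.Base using (ℕ; zero; suc)
open import Data.Product.Base using (∃; ∃₂; _×_; _,_; proj₁; proj₂)
open import Data.Sum.Base as Sum using (_⊎_; inj₁; inj₂)
open import Data.Vec.Base as Vec using (_[_]≔_)
open import Data.Vec.Properties
  using ([]=⇒lookup; lookup⇒[]=; lookup∘update′; []≔-updates; []≔-minimal; []=-injective)
open import Function.Base using (_∘_)
open import Function.Bundles using (mk⇔)
import Relation.Binary.Reasoning.Setoid as SetoidReasoning
open import Relation.Binary.PropositionalEquality as ≡ using (_≡_; _≢_)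
open import Relation.Nullary using (¬_; Dec; yes; no; contradiction; does)
open import Relation.Nullary.Decidable using (_×-dec_; ¬?; dec-true; dec-false; does-⇔)
open import Relation.Unary using (Pred; Decidable)

-- Let L be the Laplacian of G, already scaled by α, f the total weight of the spanning rooted
-- forests and P i j the weight of those in which i belongs to the tree rooted at j.  The
-- inverse of I + L is P / f: the equation to prove is
--   P i j + Σ_{e : i – k} w(e) (P i j - P k j) = δ i j · f.
-- In the sum only forests S in which i and k lie in different trees survive.  Adding e to S
-- and removing the root j from R gives a rooted forest again, with root r of the tree of i,
-- say; for a fixed result (S , R) the terms become [k is on the side of r] - [k is on the
-- side of j] after removing e from S.  As a unique edge at i leads to any other vertex of
-- its tree, they add up to [i ≠ r] - [i ≠ j], and adding [i = r], the contribution
-- of P i j = P j i, leaves [i = j].  Finally a connection from i to j is unsuccessful with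
-- weight P i i - P j i.

-- Subsets with one element removed or added.

infixl 7 _∖_ _∪₁_

_∖_ _∪₁_ : ∀ {k} → Subset k → Fin k → Subset k
S ∖ x  = S [ x ]≔ outside
S ∪₁ x = S [ x ]≔ inside

module _ {k} {S : Subset k} where

  ∉-∖ : ∀ {x} → x ∉ S ∖ x
  ∉-∖ {x} x∈ with () ← []=-injective x∈ ([]≔-updates S x)

  ∈-∪₁ : ∀ {x} → x ∈ S ∪₁ x
  ∈-∪₁ {x} = []≔-updates S x

  module _ {x y : Fin k} (y≢x : y ≢ x) where

    ∈-≔⁺ : ∀ {b} → y ∈ S → y ∈ S [ x ]≔ b
    ∈-≔⁺ = []≔-minimal S y x y≢x

    ∈-≔⁻ : ∀ {b} → y ∈ S [ x ]≔ b → y ∈ S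
    ∈-≔⁻ y∈ = lookup⇒[]= y S (≡.trans (≡.sym (lookup∘update′ y≢x S _)) ([]=⇒lookup y∈))

  ∖-⊆ : ∀ {x} → S ∖ x ⊆ S
  ∖-⊆ {x} {y} y∈ with y ≟ x
  ... | yes ≡.refl = contradiction y∈ ∉-∖
  ... | no  y≢x  = ∈-≔⁻ y≢x y∈

-- Walks and connectedness under deletion of an edge.

module MultigraphProperties {n m : ℕ} (ends : Fin m → Fin n × Fin n) where

  open Combinatorics ends

  joins-sym : ∀ {e u v} → Joins e u v → Joins e v u
  joins-sym (inj₁ p) = inj₂ p
  joins-sym (inj₂ p) = inj₁ p

  joins-unique : ∀ {e u v a b} → Joins e u v → Joins e a b → (a ≡ u × b ≡ v) ⊎ (a ≡ v × b ≡ u)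
  joins-unique (inj₁ p) (inj₁ q) with ≡.refl ← ≡.trans (≡.sym p) q = inj₁ (≡.refl , ≡.refl)
  joins-unique (inj₁ p) (inj₂ q) with ≡.refl ← ≡.trans (≡.sym p) q = inj₂ (≡.refl , ≡.refl)
  joins-unique (inj₂ p) (inj₁ q) with ≡.refl ← ≡.trans (≡.sym p) q = inj₂ (≡.refl , ≡.refl)
  joins-unique (inj₂ p) (inj₂ q) with ≡.refl ← ≡.trans (≡.sym p) q = inj₁ (≡.refl , ≡.refl)

  joins-functional : ∀ {e u v w} → Joins e u v → Joins e u w → v ≡ w
  joins-functional p q with joins-unique p q
  ... | inj₁ (_ , w≡v)     = ≡.sym w≡v
  ... | inj₂ (≡.refl , ≡.refl) = ≡.refl

  connected-refl : ∀ {S u} → Connected S u u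
  connected-refl = [] , []

  connected-trans : ∀ {S u v w} → Connected S u v → Connected S v w → Connected S u w
  connected-trans (_ , p) (_ , q) = _ , walk-trans p q

  connected-edge : ∀ {S e u v} → e ∈ S → Joins e u v → Connected S u v
  connected-edge e∈S j = _ , step e∈S j []

  connected-sym : ∀ {S u v} → Connected S u v → Connected S v u
  connected-sym (_ , [])           = connected-refl
  connected-sym (_ , step e∈S j w) =
    connected-trans (connected-sym (_ , w)) (connected-edge e∈S (joins-sym j))

  walk-restrict : ∀ {S T u ps v} → All (_∈ T) (map proj₁ ps) → Walk S u ps v → Walk T u ps v
  walk-restrict []         []           = []
  walk-restrict (e∈T ∷ es) (step _ j w) = step e∈T j (walk-restrict es w)

  walk-edges : ∀ {S u ps v} → Walk S u ps v → All (_∈ S) (map proj₁ ps)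
  walk-edges []             = []
  walk-edges (step e∈S _ w) = e∈S ∷ walk-edges w

  walk-mono : ∀ {S T u ps v} → S ⊆ T → Walk S u ps v → Walk T u ps v
  walk-mono S⊆T w = walk-restrict (All.map S⊆T (walk-edges w)) w

  connected-mono : ∀ {S T u v} → S ⊆ T → Connected S u v → Connected T u v
  connected-mono S⊆T (_ , w) = _ , walk-mono S⊆T w

  walk-avoiding : ∀ {S e u ps v} → All (e ≢_) (map proj₁ ps) → Walk S u ps v → Walk (S ∖ e) u ps v
  walk-avoiding e∉ w =
    walk-restrict (All.zipWith (λ { (e≢ , ∈S) → ∈-≔⁺ (e≢ ∘ ≡.sym) ∈S }) (e∉ , walk-edges w)) w

  -- Induction on the walk. If its first edge is `e`, then `a` is an end of `e`, and all that
  -- matters of the recursive result is how `b` is finally reached: from `a` itself, from the other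
  -- end of `e`, or from the next vertex, which is that other end.
  connected-∖ : ∀ {S e u v a b} → Joins e u v → Connected S a b →
                Connected (S ∖ e) a b ⊎
                (Connected (S ∖ e) a u × Connected (S ∖ e) v b) ⊎
                (Connected (S ∖ e) a v × Connected (S ∖ e) u b)
  connected-∖ _ (_ , []) = inj₁ connected-refl
  connected-∖ {S} {e} {u} {v} j (_ , step {e = e′} e′∈S j′ w)
    with connected-∖ j (_ , w) | e′ ≟ e
  ... | rest | no e′≢e =
    Sum.map prepend (Sum.map (λ (p , q) → prepend p , q) (λ (p , q) → prepend p , q)) rest
    where
    prepend : ∀ {c} → Connected (S ∖ e) _ c → Connected (S ∖ e) _ c
    prepend = connected-trans (connected-edge (∈-≔⁺ e′≢e e′∈S) j′)
  ... | rest | yes ≡.refl with joins-unique j j′ | rest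
  ... | inj₁ (≡.refl , ≡.refl) | inj₁ p              = inj₂ (inj₁ (connected-refl , p))
  ... | inj₁ (≡.refl , ≡.refl) | inj₂ (inj₁ (_ , q)) = inj₂ (inj₁ (connected-refl , q))
  ... | inj₁ (≡.refl , ≡.refl) | inj₂ (inj₂ (_ , q)) = inj₁ q
  ... | inj₂ (≡.refl , ≡.refl) | inj₁ p              = inj₂ (inj₂ (connected-refl , p))
  ... | inj₂ (≡.refl , ≡.refl) | inj₂ (inj₁ (_ , q)) = inj₁ q
  ... | inj₂ (≡.refl , ≡.refl) | inj₂ (inj₂ (_ , q)) = inj₂ (inj₂ (connected-refl , q))

  -- Paths and cycles

  IsPath : Subset m → Fin n → List (Fin m × Fin n) → Fin n → Set
  IsPath S u ps v = Walk S u ps v × Unique (u ∷ map proj₂ ps)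

  path-suffix : ∀ {S u w ps v} → IsPath S w ps v → u ∈ₗ w ∷ map proj₂ ps →
                ∃ λ qs → IsPath S u qs v
  path-suffix p                        (here ≡.refl) = _ , p
  path-suffix (step e∈S j w , _ ∷ uniq) (there u∈)  = path-suffix (w , uniq) u∈

  -- Loop erasure: if the start already occurs on the path found from the next vertex, only the part
  -- of that path from this occurrence on is kept.
  connected⇒path : ∀ {S u v} → Connected S u v → ∃ λ ps → IsPath S u ps v
  connected⇒path (_ , []) = [] , [] , [] ∷ []
  connected⇒path {u = u} (_ , step {w = w} e∈S j walk) with connected⇒path (_ , walk)
  ... | qs , walk′ , uniq with Any.any? (u ≟_) (w ∷ map proj₂ qs)
  ...   | yes u∈ = path-suffix (walk′ , uniq) u∈
  ...   | no  u∉ = _ , step e∈S j walk′ , ¬Any⇒All¬ _ u∉ ∷ uniq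

  -- A second use of the first edge would arrive at one of its two ends, and the later vertices of a
  -- path differ from both.
  path-edges-unique : ∀ {S u ps v} → IsPath S u ps v → Unique (map proj₁ ps)
  path-edges-unique ([] , _) = []
  path-edges-unique (step {e = e} e∈S j w , (_ ∷ u∉) ∷ w∉ ∷ uniq) =
    avoids w u∉ w∉ ∷ path-edges-unique (w , w∉ ∷ uniq)
    where
    avoids : ∀ {a ps b} → Walk _ a ps b →
             All (_ ≢_) (map proj₂ ps) → All (_ ≢_) (map proj₂ ps) → All (e ≢_) (map proj₁ ps)
    avoids []             _          _          = []
    avoids (step _ j′ w′) (u≢ ∷ us) (w≢ ∷ ws) = e≢ ∷ avoids w′ us ws
      where
      e≢ : e ≢ _
      e≢ ≡.refl with joins-unique j j′
      ... | inj₁ (_ , b≡w) = w≢ (≡.sym b≡w)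
      ... | inj₂ (_ , b≡u) = u≢ (≡.sym b≡u)

  acyclic-mono : ∀ {S T} → S ⊆ T → Acyclic T → Acyclic S
  acyclic-mono S⊆T acyclic (v , ps , ne , w , uniq) = acyclic (v , ps , ne , walk-mono S⊆T w , uniq)

  -- Otherwise a path from `v` back to `u` that avoids `e`, preceded by `e`, would be a cycle.
  acyclic-disconnects : ∀ {S e u v} → Acyclic S → e ∈ S → Joins e u v → ¬ Connected (S ∖ e) u v
  acyclic-disconnects {e = e} {u} {v} acyclic e∈S j conn with connected⇒path (connected-sym conn)
  ... | qs , path@(w , uniq) =
    acyclic (u , (e , v) ∷ qs , (λ ()) , step e∈S j (walk-mono ∖-⊆ w) ,
             All.map (λ { ∈∖ ≡.refl → ∉-∖ ∈∖ }) (walk-edges w) ∷ path-edges-unique path , uniq)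

  -- The walk together with `back` closes up, so its ends of `e` are linked the other way round. The
  -- edges before `e` are moved one by one to the end of `back`; they differ from `e` because the
  -- edges of the walk are distinct.
  walk-around : ∀ {S e u v a ps b} → Joins e u v → e ∈ₗ map proj₁ ps → Unique (map proj₁ ps) →
                Walk S a ps b → Connected (S ∖ e) b a → Connected (S ∖ e) u v
  walk-around j (here ≡.refl) (e∉ ∷ _) (step _ j′ w) back with joins-unique j j′
  ... | inj₁ (≡.refl , ≡.refl) = connected-sym (connected-trans (_ , walk-avoiding e∉ w) back)
  ... | inj₂ (≡.refl , ≡.refl) = connected-trans (_ , walk-avoiding e∉ w) back
  walk-around j (there e∈) (e∉ ∷ uniq) (step e′∈S j′ w) back =
    walk-around j e∈ uniq w
      (connected-trans back (connected-edge (∈-≔⁺ (All.lookup e∉ e∈) e′∈S) j′))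

  -- A cycle through `e` would connect the ends of `e` without it; any other cycle survives the
  -- deletion of `e`.
  acyclic-add : ∀ {S e u v} → Acyclic (S ∖ e) → Joins e u v → ¬ Connected (S ∖ e) u v → Acyclic S
  acyclic-add {e = e} acyclic j u≁v (v , ps , ne , w , uniq , uniq′) with Any.any? (e ≟_) (map proj₁ ps)
  ... | yes e∈ = u≁v (walk-around j e∈ uniq w connected-refl)
  ... | no  e∉ = acyclic (v , ps , ne , walk-avoiding (¬Any⇒All¬ _ e∉) w , uniq , uniq′)

  -- The first edge on the way to another vertex of a forest

  FirstEdge : Subset m → Fin n → Fin n → Fin n → Fin m → Set
  FirstEdge S i x k e = Joins e i k × e ∈ S × Connected (S ∖ e) k x

  firstEdge? : ∀ S i x k e → Dec (FirstEdge S i x k e)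
  firstEdge? S i x k e = joins? e i k ×-dec ((e ∈? S) ×-dec connected? (S ∖ e) k x)

  module _ {S : Subset m} {i : Fin n} (acyclic : Acyclic S) where

    firstEdge-irrefl : ∀ {k e} → ¬ FirstEdge S i i k e
    firstEdge-irrefl (j , e∈S , k∼i) = acyclic-disconnects acyclic e∈S j (connected-sym k∼i)

    -- Two different first edges would close a cycle at `i`. The connection from `k′` to `x` either
    -- avoids `e`, or reaches `i` first, or reaches `k` first; each time the ends of `e` or of `e′`
    -- are connected without that edge.
    firstEdge-unique : ∀ {x k e k′ e′} → FirstEdge S i x k e → FirstEdge S i x k′ e′ →
                       k ≡ k′ × e ≡ e′
    firstEdge-unique {x} {k} {e} {k′} {e′} (j , e∈S , k∼x) (j′ , e′∈S , k′∼x) with e ≟ e′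
    ... | yes ≡.refl = joins-functional j j′ , ≡.refl
    ... | no  e≢e′ = ⊥-elim (cases (connected-∖ j k′∼x))
      where
      weaken : ∀ {a b} → Connected (S ∖ e′ ∖ e) a b → Connected (S ∖ e) a b
      weaken = connected-mono λ {y} y∈ → case-e y y∈ (y ≟ e)
        where
        case-e : ∀ y → y ∈ S ∖ e′ ∖ e → Dec (y ≡ e) → y ∈ S ∖ e
        case-e y y∈ (yes ≡.refl) = contradiction y∈ ∉-∖
        case-e y y∈ (no  y≢e)  = ∈-≔⁺ y≢e (∖-⊆ (∖-⊆ y∈))

      i∼k′ : Connected (S ∖ e) i k′
      i∼k′ = connected-edge (∈-≔⁺ (e≢e′ ∘ ≡.sym) e′∈S) j′

      cases : ¬ _
      cases (inj₁ k′∼x) = acyclic-disconnects acyclic e∈S j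
        (connected-trans i∼k′ (connected-trans (weaken k′∼x) (connected-sym k∼x)))
      cases (inj₂ (inj₁ (k′∼i , _))) =
        acyclic-disconnects acyclic e′∈S j′ (connected-sym (connected-mono ∖-⊆ k′∼i))
      cases (inj₂ (inj₂ (k′∼k , _))) =
        acyclic-disconnects acyclic e∈S j (connected-trans i∼k′ (weaken k′∼k))

  module _ {S : Subset m} {i x : Fin n} (i≢x : i ≢ x) where

    -- Along a walk to x, the edges following the last visit of i do not meet i.
    AvoidingWalk : Fin n → List (Fin m × Fin n) → Set
    AvoidingWalk u ps = Walk S u ps x × u ≢ i × All ((_≢ i) ∘ proj₂) ps

    -- The recursion unwinds from the end of the walk. The first occurrence of `i` met in this order
    -- is the last visit, and the edge leaving it is passed on unchanged.
    lastVisit : ∀ {u ps} → Walk S u ps x →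
                (∃ λ qs → AvoidingWalk u qs) ⊎
                (∃₂ λ k e → Joins e i k × e ∈ S × ∃ λ qs → AvoidingWalk k qs)
    lastVisit [] = inj₁ ([] , [] , i≢x ∘ ≡.sym , [])
    lastVisit {u} (step e∈S j w) with lastVisit w
    ... | inj₂ found = inj₂ found
    ... | inj₁ (qs , av@(w′ , w≢i , avoids)) with u ≟ i
    ...   | yes ≡.refl = inj₂ (_ , _ , j , e∈S , qs , av)
    ...   | no  u≢i  = inj₁ (_ , step e∈S j w′ , u≢i , w≢i ∷ avoids)

    avoiding-edges : ∀ {e k u ps} → Joins e i k → AvoidingWalk u ps → All (e ≢_) (map proj₁ ps)
    avoiding-edges j ([]           , _   , _)            = []
    avoiding-edges j (step _ j′ w , u≢i , w≢i ∷ avoids) =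
      e≢ ∷ avoiding-edges j (w , w≢i , avoids)
      where
      e≢ : _ ≢ _
      e≢ ≡.refl with joins-unique j j′
      ... | inj₁ (u≡i , _) = u≢i u≡i
      ... | inj₂ (_ , w≡i) = w≢i w≡i

    firstEdge-exists : Connected S i x → ∃₂ (FirstEdge S i x)
    firstEdge-exists (_ , w) with lastVisit w
    ... | inj₁ (_ , _ , i≢i , _)           = contradiction ≡.refl i≢i
    ... | inj₂ (k , e , j , e∈S , qs , av) =
      k , e , j , e∈S , qs , walk-avoiding (avoiding-edges j av) (proj₁ av)

  -- Moving and removing roots

  IsRootOf : Subset m → Subset n → Fin n → Fin n → Set
  IsRootOf S R v r = (r ∈ R × Connected S v r) × (∀ r′ → r′ ∈ R × Connected S v r′ → r′ ≡ r)

  -- A root set containing `j` is encoded by what remains after taking `j` out. In this form the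
  -- condition depends on `j` only through its tree, so the root can be moved.
  AlmostForest : Subset m → Fin n → Subset n → Set
  AlmostForest S j R = j ∉ R × IsRootedForest (S , R ∪₁ j)

  almostForest? : ∀ S j R → Dec (AlmostForest S j R)
  almostForest? S j R = ¬? (j ∈? R) ×-dec isRootedForest? (S , R ∪₁ j)

  -- AlmostForest without reference to R ∪₁ j: the tree of j is the only one without a root.
  NearlyRooted : Subset m → Fin n → Subset n → Set
  NearlyRooted S j R =
    Acyclic S × (∀ {r} → r ∈ R → ¬ Connected S r j) × (∀ v → ¬ Connected S v j → ∃ (IsRootOf S R v))

  almost⇒nearly : ∀ {S j R} → AlmostForest S j R → NearlyRooted S j R
  almost⇒nearly {S} {j} {R} (j∉R , acyclic , roots) = acyclic , notRoot , root
    where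
    notRoot : ∀ {r} → r ∈ R → ¬ Connected S r j
    notRoot {r} r∈R r∼j with j ≟ r
    ... | yes ≡.refl = j∉R r∈R
    ... | no  j≢r  with roots r
    ...   | s , _ , uniq =
      j≢r (≡.trans (uniq j (∈-∪₁ , r∼j)) (≡.sym (uniq r (∈-≔⁺ (j≢r ∘ ≡.sym) r∈R , connected-refl))))

    root : ∀ v → ¬ Connected S v j → ∃ (IsRootOf S R v)
    root v v≁j with roots v
    ... | s , (s∈ , v∼s) , uniq =
      s , (∈-≔⁻ s≢j s∈ , v∼s) , λ r′ (r′∈R , v∼r′) → uniq r′ (∈-≔⁺ (λ { ≡.refl → v≁j v∼r′ }) r′∈R , v∼r′)
      where
      s≢j : s ≢ j
      s≢j ≡.refl = v≁j v∼s

  nearly⇒almost : ∀ {S j R} → NearlyRooted S j R → AlmostForest S j R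
  nearly⇒almost {S} {j} {R} (acyclic , notRoot , root) =
    (λ j∈R → notRoot j∈R connected-refl) , acyclic , roots
    where
    roots : ∀ v → ∃ (IsRootOf S (R ∪₁ j) v)
    roots v with connected? S v j
    ... | yes v∼j = j , (∈-∪₁ , v∼j) , unique
      where
      unique : ∀ r′ → r′ ∈ R ∪₁ j × Connected S v r′ → r′ ≡ j
      unique r′ (r′∈ , v∼r′) with r′ ≟ j
      ... | yes r′≡j = r′≡j
      ... | no  r′≢j = contradiction (connected-trans (connected-sym v∼r′) v∼j) (notRoot (∈-≔⁻ r′≢j r′∈))
    ... | no  v≁j with root v v≁j
    ...   | r , (r∈R , v∼r) , uniq =
      r , (∈-≔⁺ (λ { ≡.refl → v≁j v∼r }) r∈R , v∼r) ,
      λ r′ (r′∈ , v∼r′) → uniq r′ (∈-≔⁻ (λ { ≡.refl → v≁j v∼r′ }) r′∈ , v∼r′)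

  -- `NearlyRooted` mentions its vertex only through connectedness to it. This is the source of the
  -- symmetry of the forest matrix.
  nearly-transfer : ∀ {S i j R} → Connected S i j → NearlyRooted S i R → NearlyRooted S j R
  nearly-transfer i∼j (acyclic , notRoot , root) =
    acyclic ,
    (λ r∈R r∼j → notRoot r∈R (connected-trans r∼j (connected-sym i∼j))) ,
    (λ v v≁j → root v λ v∼i → v≁j (connected-trans v∼i i∼j))

  module _ {S : Subset m} {e : Fin m} {i k : Fin n} (e∈S : e ∈ S) (joins : Joins e i k)
           {R : Subset n} where

    private
      ∼⇒ : ∀ {a b} → Connected (S ∖ e) a b → Connected S a b
      ∼⇒ = connected-mono ∖-⊆

    -- Adding `e` attaches the rootless tree, which contains `i` and `j`, to the tree of `k`. The
    -- root `r` of the latter then serves the union, and all other trees keep their roots.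
    nearly⇒forest : ∀ {j} → ¬ Connected (S ∖ e) i k → Connected (S ∖ e) i j →
                    NearlyRooted (S ∖ e) j R →
                    IsRootedForest (S , R) × ∃ λ r → r ∈ R × Connected (S ∖ e) k r
    nearly⇒forest {j} i≁k i∼j (acyclic , notRoot , root)
      with root k (λ k∼j → i≁k (connected-trans i∼j (connected-sym k∼j)))
    ... | r , (r∈R , k∼r) , uniq = (acyclic-add acyclic joins i≁k , roots) , r , r∈R , k∼r
      where
      notRoot-i : ∀ {r′} → r′ ∈ R → ¬ Connected (S ∖ e) i r′
      notRoot-i r′∈R i∼r′ = notRoot r′∈R (connected-trans (connected-sym i∼r′) i∼j)

      k-unique : ∀ {r′} → r′ ∈ R → Connected S k r′ → r′ ≡ r
      k-unique r′∈R k∼r′ with connected-∖ joins k∼r′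
      ... | inj₁ p              = uniq _ (r′∈R , p)
      ... | inj₂ (inj₁ (_ , p)) = uniq _ (r′∈R , p)
      ... | inj₂ (inj₂ (_ , p)) = contradiction p (notRoot-i r′∈R)

      root-k : ∀ {v} → Connected S v k → IsRootOf S R v r
      root-k v∼k =
        (r∈R , connected-trans v∼k (∼⇒ k∼r)) ,
        λ r′ (r′∈R , v∼r′) → k-unique r′∈R (connected-trans (connected-sym v∼k) v∼r′)

      roots : ∀ v → ∃ (IsRootOf S R v)
      roots v with connected? S v k
      ... | yes v∼k = r , root-k v∼k
      ... | no  v≁k with root v (λ v∼j → v≁k (connected-trans (∼⇒ (connected-trans v∼j (connected-sym i∼j)))
                                                              (connected-edge e∈S joins)))
      ...   | s , (s∈R , v∼s) , s-unique = s , (s∈R , ∼⇒ v∼s) , unique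
        where
        unique : ∀ r′ → r′ ∈ R × Connected S v r′ → r′ ≡ s
        unique r′ (r′∈R , v∼r′) with connected-∖ joins v∼r′
        ... | inj₁ p              = s-unique r′ (r′∈R , p)
        ... | inj₂ (inj₁ (p , _)) = contradiction (connected-trans (∼⇒ p) (connected-edge e∈S joins)) v≁k
        ... | inj₂ (inj₂ (p , _)) = contradiction (∼⇒ p) v≁k

    -- Deleting `e` cuts a tree in two. Its only root `r` lies on the side of `k`, so the side of
    -- `i` and `j` becomes the one tree without a root.
    forest⇒nearly : ∀ {j r} → IsRootedForest (S , R) → Connected (S ∖ e) i j →
                    r ∈ R → Connected (S ∖ e) k r → NearlyRooted (S ∖ e) j R
    forest⇒nearly {j} {r} (acyclic , roots) i∼j r∈R k∼r =
      acyclic-mono ∖-⊆ acyclic , notRoot , root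
      where
      i≁k : ¬ Connected (S ∖ e) i k
      i≁k = acyclic-disconnects acyclic e∈S joins

      i∼r : Connected S i r
      i∼r = connected-trans (connected-edge e∈S joins) (∼⇒ k∼r)

      r-unique : ∀ {r′} → r′ ∈ R → Connected S i r′ → r′ ≡ r
      r-unique r′∈R i∼r′ with roots i
      ... | _ , _ , uniq = ≡.trans (uniq _ (r′∈R , i∼r′)) (≡.sym (uniq _ (r∈R , i∼r)))

      notRoot : ∀ {r′} → r′ ∈ R → ¬ Connected (S ∖ e) r′ j
      notRoot r′∈R r′∼j with r-unique r′∈R (∼⇒ (connected-trans i∼j (connected-sym r′∼j)))
      ... | ≡.refl = i≁k (connected-trans i∼j (connected-sym (connected-trans k∼r r′∼j)))

      root : ∀ v → ¬ Connected (S ∖ e) v j → ∃ (IsRootOf (S ∖ e) R v)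
      root v v≁j with roots v
      ... | s , (s∈R , v∼s) , uniq =
        s , (s∈R , v∼′s) , λ r′ (r′∈R , v∼r′) → uniq r′ (r′∈R , ∼⇒ v∼r′)
        where
        v∼′s : Connected (S ∖ e) v s
        v∼′s with connected-∖ joins v∼s
        ... | inj₁ p              = p
        ... | inj₂ (inj₁ (p , _)) = contradiction (connected-trans p i∼j) v≁j
        -- Here `i` reaches the root `s`, so `s` is `r`, which `v` reaches through `k` without using
        -- `e`.
        ... | inj₂ (inj₂ (p , q)) with ≡.refl ← r-unique s∈R (∼⇒ q) = connected-trans p k∼r

-- Sums in a commutative monoid.

module _ {a ℓ} (M : CommutativeMonoid a ℓ) where

  open CommutativeMonoid M renaming (ε to 0#)
  open import Algebra.Properties.CommutativeMonoid.Sum M using (sum; sum-cong-≋)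

  -- `g` is `f` with the entry at `i` replaced by the unit. The monoid is left general because the
  -- lemma is applied both to sums of scalars and to products of edge weights.
  sum-extract : ∀ {n} (i : Fin n) (f g : Fin n → Carrier) → g i ≈ 0# →
                (∀ k → k ≢ i → f k ≈ g k) → sum f ≈ f i ∙ sum g
  sum-extract zero f g gi≈0 f≈g =
    ∙-congˡ (trans (sum-cong-≋ λ k → f≈g (suc k) λ ()) (trans (sym (identityˡ _)) (∙-congʳ (sym gi≈0))))
  sum-extract (suc i) f g gi≈0 f≈g = begin
    f zero ∙ sum (f ∘ suc)                ≈⟨ ∙-cong (f≈g zero λ ()) (sum-extract i (f ∘ suc) (g ∘ suc) gi≈0
                                               λ k k≢i → f≈g (suc k) (k≢i ∘ suc-injective)) ⟩
    g zero ∙ (f (suc i) ∙ sum (g ∘ suc))  ≈⟨ assoc _ _ _ ⟨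
    (g zero ∙ f (suc i)) ∙ sum (g ∘ suc)  ≈⟨ ∙-congʳ (comm _ _) ⟩
    (f (suc i) ∙ g zero) ∙ sum (g ∘ suc)  ≈⟨ assoc _ _ _ ⟩
    f (suc i) ∙ sum g                     ∎
    where open SetoidReasoning setoid

module MatrixForest {c ℓ₁ ℓ₂ ℓ₃} (K : OrderedField c ℓ₁ ℓ₂ ℓ₃) where

  open OrderedField K hiding (zero)
  open ForestDistance K
  open CommutativeRing commutativeRing
    using (semiring; ring; +-commutativeMonoid; *-commutativeMonoid;
           *-commutativeSemigroup; +-commutativeSemigroup)
  open import Algebra.Properties.Semiring.Sum semiring
  open import Algebra.Properties.Ring ring
    using (-‿distribˡ-*; -‿distribʳ-*; -0#≈0#; -‿+-comm; -‿involutive)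
  open import Algebra.Properties.CommutativeSemigroup *-commutativeSemigroup
    using (x∙yz≈y∙xz; x∙yz≈z∙yx)
  open import Algebra.Properties.CommutativeSemigroup +-commutativeSemigroup
    using () renaming (interchange to +-interchange)
  open SetoidReasoning setoid

  -- Ring identities and indicators of decidable propositions.

  +-cancel : ∀ {x y z} → x + y ≈ z → x ≈ z - y
  +-cancel {x} {y} {z} x+y≈z = begin
    x            ≈⟨ +-identityʳ x ⟨
    x + 0#       ≈⟨ +-congˡ (-‿inverseʳ y) ⟨
    x + (y - y)  ≈⟨ +-assoc x y (- y) ⟨
    x + y - y    ≈⟨ +-congʳ x+y≈z ⟩
    z - y        ∎

  *-distribʳ-minus : ∀ x y z → (x - y) * z ≈ x * z - y * z
  *-distribʳ-minus x y z = trans (distribʳ z x (- y)) (+-congˡ (sym (-‿distribˡ-* y z)))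

  *-distribˡ-minus : ∀ x y z → x * (y - z) ≈ x * y - x * z
  *-distribˡ-minus x y z = trans (distribˡ x y (- z)) (+-congˡ (sym (-‿distribʳ-* x z)))

  χ : ∀ {p} {P : Set p} → Dec P → Carrier
  χ d = if does d then 1# else 0#

  module _ {p} {P : Set p} where

    χ-yes : (d : Dec P) → P → χ d ≈ 1#
    χ-yes (yes _) _ = refl
    χ-yes (no ¬p) p = contradiction p ¬p

    χ-no : (d : Dec P) → ¬ P → χ d ≈ 0#
    χ-no (yes p) ¬p = contradiction p ¬p
    χ-no (no _)  _  = refl

    χ-guard : (d : Dec P) {x y : Carrier} → (P → x ≈ y) → χ d * x ≈ χ d * y
    χ-guard (yes p) x≈y = *-congˡ (x≈y p)
    χ-guard (no _)  _   = trans (zeroˡ _) (sym (zeroˡ _))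

    χ-vanish : (d : Dec P) {x : Carrier} → (P → x ≈ 0#) → χ d * x ≈ 0#
    χ-vanish d x≈0 = trans (χ-guard d x≈0) (zeroʳ _)

    χ-¬ : (d : Dec P) → χ (¬? d) + χ d ≈ 1#
    χ-¬ (yes _) = +-identityˡ 1#
    χ-¬ (no _)  = +-identityʳ 1#

  module _ {p q} {P : Set p} {Q : Set q} where

    χ-cong : (d : Dec P) (d′ : Dec Q) → (P → Q) → (Q → P) → χ d ≈ χ d′
    χ-cong (yes p) d′ P⇒Q _   = sym (χ-yes d′ (P⇒Q p))
    χ-cong (no ¬p) d′ _   Q⇒P = sym (χ-no d′ (¬p ∘ Q⇒P))

    χ-× : (d : Dec P) (d′ : Dec Q) → χ (d ×-dec d′) ≈ χ d * χ d′
    χ-× (yes _) _ = sym (*-identityˡ _)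
    χ-× (no _)  _ = sym (zeroˡ _)

  -- Finite sums

  sum-neg : ∀ {k} (f : Fin k → Carrier) → ∑[ i < k ] (- f i) ≈ - (∑[ i < k ] f i)
  sum-neg {zero}  f = sym -0#≈0#
  sum-neg {suc k} f = trans (+-congˡ (sum-neg (f ∘ suc))) (-‿+-comm _ _)

  sum-minus : ∀ {k} (f g : Fin k → Carrier) →
              ∑[ i < k ] (f i - g i) ≈ ∑[ i < k ] f i - ∑[ i < k ] g i
  sum-minus f g = trans (∑-distrib-+ f (λ i → - g i)) (+-congˡ (sum-neg g))

  sum-zero : ∀ k {f : Fin k → Carrier} → (∀ i → f i ≈ 0#) → sum f ≈ 0#
  sum-zero k f≈0 = trans (sum-cong-≋ f≈0) (sum-replicate-zero k)

  sum-single : ∀ {k} (i : Fin k) (f : Fin k → Carrier) → (∀ j → j ≢ i → f j ≈ 0#) → sum f ≈ f i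
  sum-single {k} i f f≈0 =
    trans (sum-extract +-commutativeMonoid i f (λ _ → 0#) refl f≈0)
          (trans (+-congˡ (sum-zero k λ _ → refl)) (+-identityʳ (f i)))

  sum-δˡ : ∀ {k} (i : Fin k) (f : Fin k → Carrier) → ∑[ j < k ] (χ (i ≟ j) * f j) ≈ f i
  sum-δˡ i f = trans
    (sum-single i _ λ j j≢i → χ-vanish (i ≟ j) λ i≡j → contradiction (≡.sym i≡j) j≢i)
    (trans (*-congʳ (χ-yes (i ≟ i) ≡.refl)) (*-identityˡ (f i)))

  module _ {a} {A : Set a} where

    Σ-cong : (xs : List A) {f g : A → Carrier} → (∀ x → f x ≈ g x) → sumOver xs f ≈ sumOver xs g
    Σ-cong []       f≈g = refl
    Σ-cong (x ∷ xs) f≈g = +-cong (f≈g x) (Σ-cong xs f≈g)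

    Σ-distrib-+ : (xs : List A) (f g : A → Carrier) →
                  sumOver xs (λ x → f x + g x) ≈ sumOver xs f + sumOver xs g
    Σ-distrib-+ []       f g = sym (+-identityˡ 0#)
    Σ-distrib-+ (x ∷ xs) f g = trans (+-congˡ (Σ-distrib-+ xs f g)) (+-interchange _ _ _ _)

    *-distribˡ-Σ : ∀ a (xs : List A) (f : A → Carrier) → a * sumOver xs f ≈ sumOver xs (λ x → a * f x)
    *-distribˡ-Σ a []       f = zeroʳ a
    *-distribˡ-Σ a (x ∷ xs) f = trans (distribˡ a _ _) (+-congˡ (*-distribˡ-Σ a xs f))

    Σ-minus : (xs : List A) (f g : A → Carrier) →
              sumOver xs (λ x → f x - g x) ≈ sumOver xs f - sumOver xs g
    Σ-minus xs f g = +-cancel (trans (sym (Σ-distrib-+ xs _ g)) (Σ-cong xs λ x → begin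
      f x - g x + g x      ≈⟨ +-assoc _ _ _ ⟩
      f x + (- g x + g x)  ≈⟨ +-congˡ (-‿inverseˡ _) ⟩
      f x + 0#             ≈⟨ +-identityʳ _ ⟩
      f x                  ∎))

    Σ-++ : (xs ys : List A) (f : A → Carrier) → sumOver (xs ++ ys) f ≈ sumOver xs f + sumOver ys f
    Σ-++ []       ys f = sym (+-identityˡ _)
    Σ-++ (x ∷ xs) ys f = trans (+-congˡ (Σ-++ xs ys f)) (sym (+-assoc _ _ _))

    Σ-filter : ∀ {p} {P : Pred A p} (P? : Decidable P) (xs : List A) (f : A → Carrier) →
               sumOver (filter P? xs) f ≈ sumOver xs (λ x → χ (P? x) * f x)
    Σ-filter P? []       f = refl
    Σ-filter P? (x ∷ xs) f with does (P? x)
    ... | true  = +-cong (sym (*-identityˡ _)) (Σ-filter P? xs f)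
    ... | false = trans (Σ-filter P? xs f) (trans (sym (+-identityˡ _)) (+-congʳ (sym (zeroˡ _))))

    Σ-∑-comm : ∀ {k} (xs : List A) (f : A → Fin k → Carrier) →
               sumOver xs (λ x → ∑[ i < k ] f x i) ≈ ∑[ i < k ] sumOver xs (λ x → f x i)
    Σ-∑-comm {k} []       f = sym (sum-zero k λ _ → refl)
    Σ-∑-comm {k} (x ∷ xs) f = trans (+-congˡ (Σ-∑-comm xs f)) (sym (∑-distrib-+ (f x) _))

  Σ-map : ∀ {a b} {A : Set a} {B : Set b} (h : A → B) (xs : List A) (f : B → Carrier) →
          sumOver (map h xs) f ≈ sumOver xs (f ∘ h)
  Σ-map h []       f = refl
  Σ-map h (x ∷ xs) f = +-congˡ (Σ-map h xs f)

  Σ-cartesianProduct : ∀ {a b} {A : Set a} {B : Set b} (xs : List A) (ys : List B) (f : A × B → Carrier) →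
    sumOver (cartesianProduct xs ys) f ≈ sumOver xs (λ x → sumOver ys (λ y → f (x , y)))
  Σ-cartesianProduct []       ys f = refl
  Σ-cartesianProduct (x ∷ xs) ys f =
    trans (Σ-++ (map (x ,_) ys) _ f) (+-cong (Σ-map (x ,_) ys f) (Σ-cartesianProduct xs ys f))

  -- Matrices

  ⊗-assoc : ∀ {n} (A B C : Matrix n) → (A ⊗ B) ⊗ C ≋ A ⊗ (B ⊗ C)
  ⊗-assoc {n} A B C i j = begin
    ∑[ k < n ] (∑[ l < n ] (A i l * B l k) * C k j)    ≈⟨ sum-cong-≋ {n} (λ k → *-distribʳ-sum {n} (C k j) _) ⟩
    ∑[ k < n ] ∑[ l < n ] (A i l * B l k * C k j)      ≈⟨ ∑-comm (λ k l → A i l * B l k * C k j) ⟩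
    ∑[ l < n ] ∑[ k < n ] (A i l * B l k * C k j)      ≈⟨ sum-cong-≋ {n} (λ l → sum-cong-≋ {n} λ k → *-assoc _ _ _) ⟩
    ∑[ l < n ] ∑[ k < n ] (A i l * (B l k * C k j))    ≈⟨ sum-cong-≋ {n} (λ l → *-distribˡ-sum {n} (A i l) _) ⟨
    ∑[ l < n ] (A i l * ∑[ k < n ] (B l k * C k j))    ∎

  ⊗-cong : ∀ {n} {A A′ B B′ : Matrix n} → A ≋ A′ → B ≋ B′ → A ⊗ B ≋ A′ ⊗ B′
  ⊗-cong {n} A≋A′ B≋B′ i j = sum-cong-≋ {n} λ k → *-cong (A≋A′ i k) (B≋B′ k j)

  ⊗-identityˡ : ∀ {n} (A : Matrix n) → I ⊗ A ≋ A
  ⊗-identityˡ A i j = sum-δˡ i (λ k → A k j)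

  I-sym : ∀ {n} (i j : Fin n) → I i j ≈ I j i
  I-sym i j = χ-cong (i ≟ j) (j ≟ i) ≡.sym ≡.sym

  ⊗-identityʳ : ∀ {n} (A : Matrix n) → A ⊗ I ≋ A
  ⊗-identityʳ {n} A i j =
    trans (sum-cong-≋ {n} λ k → trans (*-comm _ _) (*-congʳ (I-sym k j))) (sum-δˡ j (A i))

  leftInverse≋rightInverse : ∀ {n} {A B C : Matrix n} → B ⊗ A ≋ I → A ⊗ C ≋ I → B ≋ C
  leftInverse≋rightInverse {A = A} {B} {C} BA≋I AC≋I i j = begin
    B i j              ≈⟨ ⊗-identityʳ B i j ⟨
    (B ⊗ I) i j        ≈⟨ ⊗-cong {A = B} (λ _ _ → refl) AC≋I i j ⟨
    (B ⊗ (A ⊗ C)) i j  ≈⟨ ⊗-assoc B A C i j ⟨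
    ((B ⊗ A) ⊗ C) i j  ≈⟨ ⊗-cong {B = C} BA≋I (λ _ _ → refl) i j ⟩
    (I ⊗ C) i j        ≈⟨ ⊗-identityˡ C i j ⟩
    C i j              ∎

  Symmetric : ∀ {n} → Matrix n → Set ℓ₁
  Symmetric A = ∀ i j → A i j ≈ A j i

  -- Transposing the equation `A ⊗ B ≋ I` exchanges the two factors.
  symmetric-rightInverse : ∀ {n} {A B : Matrix n} → Symmetric A → Symmetric B → A ⊗ B ≋ I → B IsInverseOf A
  symmetric-rightInverse {n} A-sym B-sym AB≋I = AB≋I , λ i j →
    trans (sum-cong-≋ {n} λ k → trans (*-comm _ _) (*-cong (A-sym k j) (B-sym i k)))
          (trans (AB≋I j i) (I-sym j i))

  inverse-inverseʳ : ∀ x (0<x : 0# < x) → x * inverse x 0<x ≈ 1#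
  -- `inverse x` is by construction an inverse of `x - 0#`, so `x` is first rewritten to that
  -- difference.
  inverse-inverseʳ x 0<x = trans (*-congʳ (sym (trans (+-congˡ -0#≈0#) (+-identityʳ x))))
                                 (proj₂ (proj₂ (#⇒invertible (#-sym (<⇒# 0<x)))))

  -- Counting rooted forests with a given edge set

  module Forests {n m : ℕ} (ends : Fin m → Fin n × Fin n) where

    open Combinatorics ends
    open MultigraphProperties ends

    Σ-subsets : ∀ {k} (f : Subset (suc k) → Carrier) →
                sumOver (subsets (suc k)) f ≈
                sumOver (subsets k) (f ∘ (outside Vec.∷_)) + sumOver (subsets k) (f ∘ (inside Vec.∷_))
    Σ-subsets {k} f = trans (Σ-++ (map (outside Vec.∷_) (subsets k)) _ f)
                            (+-cong (Σ-map _ (subsets k) f) (Σ-map _ (subsets k) f))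

    -- Removing `x` is a bijection from the subsets containing `x` onto those that do not. The
    -- summand receives both partners, so it may be read on either side. At position `zero` the
    -- bijection merely exchanges the two halves of the enumeration.
    Σ-∖-reindex : ∀ {k} (x : Fin k) (f : Subset k → Subset k → Carrier) →
                  sumOver (subsets k) (λ S → χ (x ∈? S) * f (S ∖ x) S) ≈
                  sumOver (subsets k) (λ S → χ (¬? (x ∈? S)) * f S (S ∪₁ x))
    Σ-∖-reindex {suc k} zero f = begin
      sumOver (subsets (suc k)) (λ S → χ (zero ∈? S) * f (S ∖ zero) S)
        ≈⟨ Σ-subsets (λ S → χ (zero ∈? S) * f (S ∖ zero) S) ⟩
      sumOver (subsets k) (λ S → 0# * f (outside Vec.∷ S) (outside Vec.∷ S)) +
      sumOver (subsets k) (λ S → 1# * f (outside Vec.∷ S) (inside Vec.∷ S))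
        ≈⟨ +-comm _ _ ⟩
      sumOver (subsets k) (λ S → 1# * f (outside Vec.∷ S) (inside Vec.∷ S)) +
      sumOver (subsets k) (λ S → 0# * f (outside Vec.∷ S) (outside Vec.∷ S))
        ≈⟨ +-congˡ (Σ-cong (subsets k) λ S → trans (zeroˡ _) (sym (zeroˡ _))) ⟩
      sumOver (subsets k) (λ S → 1# * f (outside Vec.∷ S) (inside Vec.∷ S)) +
      sumOver (subsets k) (λ S → 0# * f (inside Vec.∷ S) (inside Vec.∷ S))
        ≈⟨ Σ-subsets (λ S → χ (¬? (zero ∈? S)) * f S (S ∪₁ zero)) ⟨
      sumOver (subsets (suc k)) (λ S → χ (¬? (zero ∈? S)) * f S (S ∪₁ zero)) ∎
    Σ-∖-reindex {suc k} (suc x) f = begin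
      sumOver (subsets (suc k)) (λ S → χ (suc x ∈? S) * f (S ∖ suc x) S)
        ≈⟨ Σ-subsets (λ S → χ (suc x ∈? S) * f (S ∖ suc x) S) ⟩
      _
        ≈⟨ +-cong (Σ-∖-reindex x λ S T → f (outside Vec.∷ S) (outside Vec.∷ T))
                  (Σ-∖-reindex x λ S T → f (inside Vec.∷ S) (inside Vec.∷ T)) ⟩
      _
        ≈⟨ Σ-subsets (λ S → χ (¬? (suc x ∈? S)) * f S (S ∪₁ suc x)) ⟨
      sumOver (subsets (suc k)) (λ S → χ (¬? (suc x ∈? S)) * f S (S ∪₁ suc x)) ∎

    conn : Subset m → Fin n → Fin n → Carrier
    conn S u v = χ (connected? S u v)

    forest : Subset m → Subset n → Carrier
    forest S R = χ (isRootedForest? (S , R))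

    almost : Subset m → Fin n → Subset n → Carrier
    almost S j R = χ (almostForest? S j R)

    conn-sym : ∀ S u v → conn S u v ≈ conn S v u
    conn-sym S u v = χ-cong (connected? S u v) (connected? S v u) connected-sym connected-sym

    -- A count of root sets, taken in the field: those that make `S` a rooted forest in which `i`
    -- lies in the tree rooted at `j`.
    rooted : Subset m → Fin n → Fin n → Carrier
    rooted S i j = sumOver (subsets n) λ R → conn S i j * (χ (j ∈? R) * forest S R)

    rooted-almost : ∀ S i j → rooted S i j ≈ sumOver (subsets n) (λ R → conn S i j * almost S j R)
    rooted-almost S i j = begin
      rooted S i j
        ≈⟨ *-distribˡ-Σ (conn S i j) (subsets n) _ ⟨
      conn S i j * sumOver (subsets n) (λ R → χ (j ∈? R) * forest S R)
        ≈⟨ *-congˡ (Σ-∖-reindex j λ _ R → forest S R) ⟩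
      conn S i j * sumOver (subsets n) (λ R → χ (¬? (j ∈? R)) * forest S (R ∪₁ j))
        ≈⟨ *-congˡ (Σ-cong (subsets n) λ R → χ-× (¬? (j ∈? R)) (isRootedForest? (S , R ∪₁ j))) ⟨
      conn S i j * sumOver (subsets n) (almost S j)
        ≈⟨ *-distribˡ-Σ (conn S i j) (subsets n) _ ⟩
      sumOver (subsets n) (λ R → conn S i j * almost S j R) ∎

    -- Once the root `j` is taken out of the root set, what remains allows `i` to be put in its
    -- place whenever `i` and `j` share a tree.
    rooted-sym : ∀ S i j → rooted S i j ≈ rooted S j i
    rooted-sym S i j = begin
      rooted S i j                                           ≈⟨ rooted-almost S i j ⟩
      sumOver (subsets n) (λ R → conn S i j * almost S j R)  ≈⟨ Σ-cong (subsets n) moveRoot ⟩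
      sumOver (subsets n) (λ R → conn S j i * almost S i R)  ≈⟨ rooted-almost S j i ⟨
      rooted S j i                                           ∎
      where
      transfer : ∀ {i j} R → Connected S i j → AlmostForest S i R → AlmostForest S j R
      transfer R i∼j = nearly⇒almost ∘ nearly-transfer i∼j ∘ almost⇒nearly

      moveRoot : ∀ R → conn S i j * almost S j R ≈ conn S j i * almost S i R
      moveRoot R = trans
        (χ-guard (connected? S i j) λ i∼j →
          χ-cong (almostForest? S j R) (almostForest? S i R)
                 (transfer R (connected-sym i∼j)) (transfer R i∼j))
        (*-congʳ (conn-sym S i j))

    -- Exactly one first edge leads to each other vertex of the tree of `i` and none to `i` itself;
    -- the extra indicator makes up for the latter case.
    firstEdge-count : ∀ {S i x} → Acyclic S → Connected S i x →
      ∑[ k < n ] ∑[ e < m ] χ (firstEdge? S i x k e) + χ (i ≟ x) ≈ 1#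
    firstEdge-count {S} {i} {x} acyclic i∼x with i ≟ x
    ... | yes ≡.refl = trans
      (+-congʳ (sum-zero n λ k → sum-zero m λ e → χ-no (firstEdge? S i i k e) (firstEdge-irrefl acyclic)))
      (+-identityˡ 1#)
    ... | no i≢x with firstEdge-exists i≢x i∼x
    ...   | k , e , fe = begin
      ∑[ k < n ] ∑[ e < m ] χ (firstEdge? S i x k e) + 0#  ≈⟨ +-identityʳ _ ⟩
      ∑[ k < n ] ∑[ e < m ] χ (firstEdge? S i x k e)
        ≈⟨ sum-single k _ (λ k′ k′≢k → sum-zero m λ e′ →
             χ-no (firstEdge? S i x k′ e′) λ fe′ → k′≢k (proj₁ (firstEdge-unique acyclic fe′ fe))) ⟩
      ∑[ e < m ] χ (firstEdge? S i x k e)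
        ≈⟨ sum-single e _ (λ e′ e′≢e →
             χ-no (firstEdge? S i x k e′) λ fe′ → e′≢e (proj₂ (firstEdge-unique acyclic fe′ fe))) ⟩
      χ (firstEdge? S i x k e)                             ≈⟨ χ-yes (firstEdge? S i x k e) fe ⟩
      1#                                                   ∎

    -- Trading the root `j` for an edge at `i`.

    module _ (S : Subset m) (R : Subset n) (i j : Fin n) where

      -- The contribution of the edge e, joining i to k, to the entry (i , j) of the
      -- Laplacian times the forest matrix, read on the forest S from which e is removed
      -- and on the root set R from which j is removed.
      exchange : Fin n → Fin m → Carrier
      exchange k e =
        χ (joins? e i k) * (χ (e ∈? S) * ((conn (S ∖ e) i j - conn (S ∖ e) k j) * almost (S ∖ e) j R))

      exchange-zero : (∀ {k e} → Joins e i k → e ∈ S →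
                        (conn (S ∖ e) i j - conn (S ∖ e) k j) * almost (S ∖ e) j R ≈ 0#) →
                      ∑[ k < n ] ∑[ e < m ] exchange k e ≈ 0#
      exchange-zero vanish = sum-zero n λ k → sum-zero m λ e →
        χ-vanish (joins? e i k) λ joins → χ-vanish (e ∈? S) λ e∈S → vanish joins e∈S

      minus-vanish : ∀ {x y z} → x ≈ y → (x - y) * z ≈ 0#
      minus-vanish x≈y = trans (*-congʳ (trans (+-congʳ x≈y) (-‿inverseʳ _))) (zeroˡ _)

      -- If `i` and `k` stay connected without `e`, the two indicators agree. If they do not, and
      -- `R` lacks only the root `j`, then `j` on the side of `i` or of `k` would make `(S , R)` a
      -- rooted forest by `nearly⇒forest`, so both indicators are zero.
      exchange-nonforest : ¬ IsRootedForest (S , R) → ∑[ k < n ] ∑[ e < m ] exchange k e ≈ 0#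
      exchange-nonforest ¬forest = exchange-zero vanish
        where
        vanish : ∀ {k e} → Joins e i k → e ∈ S →
                 (conn (S ∖ e) i j - conn (S ∖ e) k j) * almost (S ∖ e) j R ≈ 0#
        vanish {k} {e} joins e∈S = cases (almostForest? (S ∖ e) j R) (connected? (S ∖ e) i k)
          where
          cases : Dec (AlmostForest (S ∖ e) j R) → Dec (Connected (S ∖ e) i k) →
                  (conn (S ∖ e) i j - conn (S ∖ e) k j) * almost (S ∖ e) j R ≈ 0#
          cases (no ¬af) _         = trans (*-congˡ (χ-no (almostForest? (S ∖ e) j R) ¬af)) (zeroʳ _)
          cases (yes _)  (yes i∼k) = minus-vanish
            (χ-cong (connected? (S ∖ e) i j) (connected? (S ∖ e) k j)
              (connected-trans (connected-sym i∼k)) (connected-trans i∼k))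
          cases (yes af) (no i≁k)  = minus-vanish (trans
            (χ-no (connected? (S ∖ e) i j) λ i∼j →
              ¬forest (proj₁ (nearly⇒forest e∈S joins i≁k i∼j (almost⇒nearly af))))
            (sym (χ-no (connected? (S ∖ e) k j) λ k∼j →
              ¬forest (proj₁ (nearly⇒forest e∈S (joins-sym joins) (i≁k ∘ connected-sym) k∼j (almost⇒nearly af))))))

      -- The edge `e` puts `k` in the tree of `i`, so `j` is out of reach from both.
      exchange-disconnected : ¬ Connected S i j → ∑[ k < n ] ∑[ e < m ] exchange k e ≈ 0#
      exchange-disconnected i≁j = exchange-zero λ {k} {e} joins e∈S → minus-vanish (trans
        (χ-no (connected? (S ∖ e) i j) λ i∼j → i≁j (connected-mono ∖-⊆ i∼j))
        (sym (χ-no (connected? (S ∖ e) k j)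
          λ k∼j → i≁j (connected-trans (connected-edge e∈S joins) (connected-mono ∖-⊆ k∼j)))))

      -- S ∖ e has i and k in different trees, so R ∪₁ j is a root set exactly when j
      -- and the old root r lie on different sides of e.
      exchange-forest : ∀ {r} → IsRootedForest (S , R) → Connected S i j → r ∈ R → Connected S i r →
                        ∀ k e → exchange k e ≈ χ (firstEdge? S i r k e) - χ (firstEdge? S i j k e)
      exchange-forest {r} isForest@(acyclic , _) i∼j r∈R i∼r k e = begin
        exchange k e
          ≈⟨ χ-guard (joins? e i k) (λ joins → χ-guard (e ∈? S) (λ e∈S →
               let open Joined joins e∈S in cases (side i∼j) (side i∼r))) ⟩
        χ (joins? e i k) * (χ (e ∈? S) * (conn (S ∖ e) k r - conn (S ∖ e) k j))
          ≈⟨ *-congˡ (*-distribˡ-minus _ _ _) ⟩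
        χ (joins? e i k) * (χ (e ∈? S) * conn (S ∖ e) k r - χ (e ∈? S) * conn (S ∖ e) k j)
          ≈⟨ *-distribˡ-minus _ _ _ ⟩
        χ (joins? e i k) * (χ (e ∈? S) * conn (S ∖ e) k r) -
        χ (joins? e i k) * (χ (e ∈? S) * conn (S ∖ e) k j)
          ≈⟨ +-cong (χ-firstEdge r) (-‿cong (χ-firstEdge j)) ⟨
        χ (firstEdge? S i r k e) - χ (firstEdge? S i j k e) ∎
        where
        χ-firstEdge : ∀ x → χ (firstEdge? S i x k e) ≈ χ (joins? e i k) * (χ (e ∈? S) * conn (S ∖ e) k x)
        χ-firstEdge x = trans
          (χ-× (joins? e i k) ((e ∈? S) ×-dec connected? (S ∖ e) k x))
          (*-congˡ (χ-× (e ∈? S) (connected? (S ∖ e) k x)))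

        module Joined (joins : Joins e i k) (e∈S : e ∈ S) where

          i≁k : ¬ Connected (S ∖ e) i k
          i≁k = acyclic-disconnects acyclic e∈S joins

          side : ∀ {x} → Connected S i x → Connected (S ∖ e) i x ⊎ Connected (S ∖ e) k x
          side i∼x with connected-∖ joins i∼x
          ... | inj₁ p              = inj₁ p
          ... | inj₂ (inj₁ (_ , p)) = inj₂ p
          ... | inj₂ (inj₂ (_ , p)) = inj₁ p

          not-both : ∀ {x} → Connected (S ∖ e) i x → ¬ Connected (S ∖ e) k x
          not-both p q = i≁k (connected-trans p (connected-sym q))

          i-side : ∀ {x} → Connected (S ∖ e) i x → conn (S ∖ e) i x ≈ 1# × conn (S ∖ e) k x ≈ 0#
          i-side {x} p = χ-yes (connected? (S ∖ e) i x) p , χ-no (connected? (S ∖ e) k x) (not-both p)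

          k-side : ∀ {x} → Connected (S ∖ e) k x → conn (S ∖ e) i x ≈ 0# × conn (S ∖ e) k x ≈ 1#
          k-side {x} p = χ-no (connected? (S ∖ e) i x) (λ q → not-both q p) , χ-yes (connected? (S ∖ e) k x) p

          almost-yes : NearlyRooted (S ∖ e) j R → almost (S ∖ e) j R ≈ 1#
          almost-yes = χ-yes (almostForest? (S ∖ e) j R) ∘ nearly⇒almost

          almost-no : ¬ NearlyRooted (S ∖ e) j R → almost (S ∖ e) j R ≈ 0#
          almost-no ¬nearly = χ-no (almostForest? (S ∖ e) j R) (¬nearly ∘ almost⇒nearly)

          cases : Connected (S ∖ e) i j ⊎ Connected (S ∖ e) k j →
                  Connected (S ∖ e) i r ⊎ Connected (S ∖ e) k r →
                  (conn (S ∖ e) i j - conn (S ∖ e) k j) * almost (S ∖ e) j R ≈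
                  conn (S ∖ e) k r - conn (S ∖ e) k j
          cases (inj₁ i∼j) (inj₂ k∼r) = trans
            (*-cong (+-congʳ (proj₁ (i-side i∼j))) (almost-yes (forest⇒nearly e∈S joins isForest i∼j r∈R k∼r)))
            (trans (*-identityʳ _) (+-congʳ (sym (proj₂ (k-side k∼r)))))
          cases (inj₂ k∼j) (inj₁ i∼r) = trans
            (*-cong (+-congʳ (proj₁ (k-side k∼j)))
                    (almost-yes (forest⇒nearly e∈S (joins-sym joins) isForest k∼j r∈R i∼r)))
            (trans (*-identityʳ _) (+-congʳ (sym (proj₂ (i-side i∼r)))))
          -- When `j` and `r` lie on the same side, that side already has the root `r`, so `almost`
          -- vanishes; on the right, `k` reaches both vertices or neither.
          cases (inj₁ i∼j) (inj₁ i∼r) = trans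
            (*-congˡ (almost-no λ (_ , notRoot , _) →
               notRoot r∈R (connected-trans (connected-sym i∼r) i∼j)))
            (trans (zeroʳ _) (sym (trans (+-cong (proj₂ (i-side i∼r)) (-‿cong (proj₂ (i-side i∼j))))
                                          (-‿inverseʳ 0#))))
          cases (inj₂ k∼j) (inj₂ k∼r) = trans
            (*-congˡ (almost-no λ (_ , notRoot , _) →
               notRoot r∈R (connected-trans (connected-sym k∼r) k∼j)))
            (trans (zeroʳ _) (sym (trans (+-cong (proj₂ (k-side k∼r)) (-‿cong (proj₂ (k-side k∼j))))
                                          (-‿inverseʳ 1#))))

      exchange-balance : conn S i j * (χ (i ∈? R) * forest S R) + ∑[ k < n ] ∑[ e < m ] exchange k e ≈
                         χ (i ≟ j) * forest S R
      exchange-balance = cases (isRootedForest? (S , R)) (connected? S i j)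
        where
        cases : Dec (IsRootedForest (S , R)) → Dec (Connected S i j) →
                conn S i j * (χ (i ∈? R) * forest S R) + ∑[ k < n ] ∑[ e < m ] exchange k e ≈
                χ (i ≟ j) * forest S R
        cases (no ¬forest) _ = trans
          (+-cong (trans (*-congˡ (trans (*-congˡ forest≈0) (zeroʳ _))) (zeroʳ _)) (exchange-nonforest ¬forest))
          (trans (+-identityʳ 0#) (sym (trans (*-congˡ forest≈0) (zeroʳ _))))
          where
          forest≈0 : forest S R ≈ 0#
          forest≈0 = χ-no (isRootedForest? (S , R)) ¬forest
        cases (yes _) (no i≁j) = trans
          (+-cong (trans (*-congʳ (χ-no (connected? S i j) i≁j)) (zeroˡ _)) (exchange-disconnected i≁j))
          (trans (+-identityʳ 0#)
            (sym (trans (*-congʳ (χ-no (i ≟ j) λ { ≡.refl → i≁j connected-refl })) (zeroˡ _))))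
        cases (yes isForest@(acyclic , roots)) (yes i∼j) with roots i
        ... | r , (r∈R , i∼r) , r-unique = begin
          conn S i j * (χ (i ∈? R) * forest S R) + ∑[ k < n ] ∑[ e < m ] exchange k e
            ≈⟨ +-cong (trans (*-cong (χ-yes (connected? S i j) i∼j) (trans (*-congˡ forest≈1) (*-identityʳ _)))
                             (*-identityˡ _))
                      (sum-cong-≋ {n} λ k → sum-cong-≋ {m} λ e → exchange-forest isForest i∼j r∈R i∼r k e) ⟩
          χ (i ∈? R) + ∑[ k < n ] ∑[ e < m ] (A k e - B k e)
            -- `i` is a root exactly when it is the root `r` of its own tree.
            ≈⟨ +-cong (χ-cong (i ∈? R) (i ≟ r) (λ i∈R → r-unique i (i∈R , connected-refl)) λ { ≡.refl → r∈R })
                      (trans (sum-cong-≋ {n} λ k → sum-minus (A k) (B k)) (sum-minus {n} _ _)) ⟩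
          χ (i ≟ r) + (∑[ k < n ] ∑[ e < m ] A k e - ∑[ k < n ] ∑[ e < m ] B k e)
            ≈⟨ +-assoc _ _ _ ⟨
          χ (i ≟ r) + ∑[ k < n ] ∑[ e < m ] A k e - ∑[ k < n ] ∑[ e < m ] B k e
            -- The count towards the root `r` completes `χ (i ≟ r)` to `1#`; the count towards `j`
            -- is then what separates `1#` from `χ (i ≟ j)`.
            ≈⟨ +-congʳ (trans (+-comm _ _) (firstEdge-count acyclic i∼r)) ⟩
          1# - ∑[ k < n ] ∑[ e < m ] B k e
            ≈⟨ +-cancel (trans (+-comm _ _) (firstEdge-count acyclic i∼j)) ⟨
          χ (i ≟ j)               ≈⟨ *-identityʳ _ ⟨
          χ (i ≟ j) * 1#          ≈⟨ *-congˡ forest≈1 ⟨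
          χ (i ≟ j) * forest S R  ∎
          where
          forest≈1 : forest S R ≈ 1#
          forest≈1 = χ-yes (isRootedForest? (S , R)) isForest

          A B : Fin n → Fin m → Carrier
          A k e = χ (firstEdge? S i r k e)
          B k e = χ (firstEdge? S i j k e)

    rooted-difference : ∀ S i k j → rooted S i j - rooted S k j ≈
                        sumOver (subsets n) (λ R → (conn S i j - conn S k j) * almost S j R)
    rooted-difference S i k j = begin
      rooted S i j - rooted S k j
        ≈⟨ +-cong (rooted-almost S i j) (-‿cong (rooted-almost S k j)) ⟩
      sumOver (subsets n) (λ R → conn S i j * almost S j R) -
      sumOver (subsets n) (λ R → conn S k j * almost S j R)
        ≈⟨ Σ-minus (subsets n) _ _ ⟨
      sumOver (subsets n) (λ R → conn S i j * almost S j R - conn S k j * almost S j R)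
        ≈⟨ Σ-cong (subsets n) (λ R → *-distribʳ-minus _ _ _) ⟨
      sumOver (subsets n) (λ R → (conn S i j - conn S k j) * almost S j R) ∎

    -- The matrix equation for one fixed edge set: the Laplacian terms gathered here come from the
    -- sets that become `S` when the edge `e` is added.
    rooted-balance : ∀ S i j →
      rooted S i j + ∑[ k < n ] ∑[ e < m ] (χ (joins? e i k) *
                       (χ (e ∈? S) * (rooted (S ∖ e) i j - rooted (S ∖ e) k j))) ≈
      χ (i ≟ j) * sumOver (subsets n) (forest S)
    rooted-balance S i j = begin
      rooted S i j + ∑[ k < n ] ∑[ e < m ] (χ (joins? e i k) *
                       (χ (e ∈? S) * (rooted (S ∖ e) i j - rooted (S ∖ e) k j)))
        -- The root is moved from `j` to `i` because `exchange-balance` is phrased with `i` in the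
        -- root set.
        ≈⟨ +-cong (trans (rooted-sym S i j) (Σ-cong (subsets n) λ R → *-congʳ (conn-sym S j i)))
                  (sum-cong-≋ {n} λ k → sum-cong-≋ {m} λ e → expand k e) ⟩
      sumOver (subsets n) (λ R → conn S i j * (χ (i ∈? R) * forest S R)) +
      ∑[ k < n ] ∑[ e < m ] sumOver (subsets n) (λ R → exchange S R i j k e)
        ≈⟨ +-congˡ (trans (Σ-∑-comm {k = n} (subsets n) _)
                          (sum-cong-≋ {n} λ k → Σ-∑-comm {k = m} (subsets n) _)) ⟨
      sumOver (subsets n) (λ R → conn S i j * (χ (i ∈? R) * forest S R)) +
      sumOver (subsets n) (λ R → ∑[ k < n ] ∑[ e < m ] exchange S R i j k e)
        ≈⟨ Σ-distrib-+ (subsets n) _ _ ⟨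
      sumOver (subsets n) (λ R → conn S i j * (χ (i ∈? R) * forest S R) +
                                 ∑[ k < n ] ∑[ e < m ] exchange S R i j k e)
        ≈⟨ Σ-cong (subsets n) (λ R → exchange-balance S R i j) ⟩
      sumOver (subsets n) (λ R → χ (i ≟ j) * forest S R)
        ≈⟨ *-distribˡ-Σ (χ (i ≟ j)) (subsets n) _ ⟨
      χ (i ≟ j) * sumOver (subsets n) (forest S) ∎
      where
      expand : ∀ k e → χ (joins? e i k) * (χ (e ∈? S) * (rooted (S ∖ e) i j - rooted (S ∖ e) k j)) ≈
                       sumOver (subsets n) (λ R → exchange S R i j k e)
      expand k e = trans
        (*-congˡ (trans (*-congˡ (rooted-difference (S ∖ e) i k j)) (*-distribˡ-Σ _ (subsets n) _)))
        (*-distribˡ-Σ _ (subsets n) _)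

  -- Weighted sums over forests

  module Accessibility {n : ℕ} (G : WeightedMultigraph n) where

    open WeightedMultigraph G
    open MultigraphProperties ends
    open Forests ends

    -- The weight of a forest depends on its edges alone, so `∅` stands for an arbitrary root set.
    w : Subset size → Carrier
    w S = ε G (S , ∅)

    w-∖ : ∀ {S e} → e ∈ S → w S ≈ weight e * w (S ∖ e)
    w-∖ {S} {e} e∈S = trans
      (sum-extract *-commutativeMonoid e (factor S) (factor (S ∖ e))
        (reflexive (≡.cong (if_then weight e else 1#) (dec-false (e ∈? S ∖ e) ∉-∖)))
        λ k k≢e → reflexive (≡.cong (if_then weight k else 1#)
          (does-⇔ (mk⇔ (∈-≔⁺ k≢e) (∈-≔⁻ k≢e)) (k ∈? S) (k ∈? S ∖ e))))
      (*-congʳ (reflexive (≡.cong (if_then weight e else 1#) (dec-true (e ∈? S) e∈S))))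
      where
      factor : Subset size → Fin size → Carrier
      factor S e = if does (e ∈? S) then weight e else 1#

    -- The matrix called P in the opening explanation.
    treeWeight : Matrix n
    treeWeight i j = sumOver (subsets size) λ S → w S * rooted S i j

    treeWeight-sym : Symmetric treeWeight
    treeWeight-sym i j = Σ-cong (subsets size) λ S → *-congˡ (rooted-sym S i j)

    Σ-forests : ∀ (f : RootedSubgraph → Carrier) →
      sumOver spanningRootedForests f ≈
      sumOver (subsets size) (λ S → sumOver (subsets n) (λ R → forest S R * f (S , R)))
    Σ-forests f = trans (Σ-filter isRootedForest? (cartesianProduct (subsets size) (subsets n)) f)
                        (Σ-cartesianProduct (subsets size) (subsets n) _)

    totalForestWeight≈ : totalForestWeight G ≈
                         sumOver (subsets size) (λ S → w S * sumOver (subsets n) (forest S))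
    totalForestWeight≈ = trans (Σ-forests (ε G)) (Σ-cong (subsets size) λ S →
      trans (Σ-cong (subsets n) λ R → *-comm _ _) (sym (*-distribˡ-Σ (w S) (subsets n) _)))

    -- Edge sets containing `e` cancel, since there `i` and `k` lie in the same tree. In the others
    -- `e` is added by reindexing, and the factor `weight e` is absorbed into the weight of the
    -- enlarged set.
    edge-contribution : ∀ {e i k} → Joins e i k → ∀ j →
      weight e * (treeWeight i j - treeWeight k j) ≈
      sumOver (subsets size) (λ S → χ (e ∈? S) * (w S * (rooted (S ∖ e) i j - rooted (S ∖ e) k j)))
    edge-contribution {e} {i} {k} joins j = begin
      weight e * (treeWeight i j - treeWeight k j)
        ≈⟨ *-congˡ (trans (Σ-cong (subsets size) λ S → *-distribˡ-minus _ _ _) (Σ-minus (subsets size) _ _)) ⟨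
      weight e * sumOver (subsets size) (λ S → w S * Δ S)
        ≈⟨ *-distribˡ-Σ (weight e) (subsets size) _ ⟩
      sumOver (subsets size) (λ S → weight e * (w S * Δ S))
        ≈⟨ Σ-cong (subsets size) (λ S → drop S (e ∈? S)) ⟨
      sumOver (subsets size) (λ S → χ (¬? (e ∈? S)) * (weight e * (w S * Δ S)))
        ≈⟨ Σ-∖-reindex e (λ S _ → weight e * (w S * Δ S)) ⟨
      sumOver (subsets size) (λ S → χ (e ∈? S) * (weight e * (w (S ∖ e) * Δ (S ∖ e))))
        ≈⟨ Σ-cong (subsets size) (λ S → χ-guard (e ∈? S) λ e∈S →
             trans (sym (*-assoc _ _ _)) (*-congʳ (sym (w-∖ e∈S)))) ⟩
      sumOver (subsets size) (λ S → χ (e ∈? S) * (w S * Δ (S ∖ e))) ∎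
      where
      Δ : Subset size → Carrier
      Δ S = rooted S i j - rooted S k j

      drop : ∀ S (d : Dec (e ∈ S)) → χ (¬? d) * (weight e * (w S * Δ S)) ≈ weight e * (w S * Δ S)
      drop S (no _)    = *-identityˡ _
      drop S (yes e∈S) = trans (zeroˡ _) (sym (trans (*-congˡ (trans (*-congˡ Δ≈0) (zeroʳ _))) (zeroʳ _)))
        where
        i∼k : Connected S i k
        i∼k = connected-edge e∈S joins

        Δ≈0 : Δ S ≈ 0#
        Δ≈0 = trans (+-congʳ (Σ-cong (subsets n) λ R → *-congʳ
          (χ-cong (connected? S i j) (connected? S k j)
            (connected-trans (connected-sym i∼k)) (connected-trans i∼k)))) (-‿inverseʳ _)

    -- This is `rooted-balance` summed over all edge sets with weights `w S`, after
    -- `edge-contribution` has moved each Laplacian term to the set containing its edge.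
    treeWeight-balance : ∀ i j →
      treeWeight i j + ∑[ k < n ] ∑[ e < size ] (χ (joins? e i k) *
                         (weight e * (treeWeight i j - treeWeight k j))) ≈
      I i j * totalForestWeight G
    treeWeight-balance i j = begin
      treeWeight i j + ∑[ k < n ] ∑[ e < size ] (χ (joins? e i k) *
                         (weight e * (treeWeight i j - treeWeight k j)))
        ≈⟨ +-congˡ (sum-cong-≋ {n} λ k → sum-cong-≋ {size} λ e → expand k e) ⟩
      treeWeight i j + ∑[ k < n ] ∑[ e < size ] sumOver (subsets size) (λ S → w S * term S k e)
        ≈⟨ +-congˡ (trans (Σ-∑-comm {k = n} (subsets size) _)
                          (sum-cong-≋ {n} λ k → Σ-∑-comm {k = size} (subsets size) _)) ⟨
      treeWeight i j + sumOver (subsets size) (λ S → ∑[ k < n ] ∑[ e < size ] (w S * term S k e))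
        ≈⟨ Σ-distrib-+ (subsets size) _ _ ⟨
      sumOver (subsets size) (λ S → w S * rooted S i j + ∑[ k < n ] ∑[ e < size ] (w S * term S k e))
        ≈⟨ Σ-cong (subsets size) collect ⟩
      sumOver (subsets size) (λ S → I i j * (w S * sumOver (subsets n) (forest S)))
        ≈⟨ *-distribˡ-Σ (I i j) (subsets size) _ ⟨
      I i j * sumOver (subsets size) (λ S → w S * sumOver (subsets n) (forest S))
        ≈⟨ *-congˡ totalForestWeight≈ ⟨
      I i j * totalForestWeight G ∎
      where
      term : Subset size → Fin n → Fin size → Carrier
      term S k e = χ (joins? e i k) * (χ (e ∈? S) * (rooted (S ∖ e) i j - rooted (S ∖ e) k j))

      expand : ∀ k e → χ (joins? e i k) * (weight e * (treeWeight i j - treeWeight k j)) ≈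
                       sumOver (subsets size) (λ S → w S * term S k e)
      expand k e = begin
        χ (joins? e i k) * (weight e * (treeWeight i j - treeWeight k j))
          ≈⟨ χ-guard (joins? e i k) (λ joins → edge-contribution joins j) ⟩
        χ (joins? e i k) * sumOver (subsets size) (λ S → χ (e ∈? S) * (w S * _))
          ≈⟨ *-distribˡ-Σ _ (subsets size) _ ⟩
        sumOver (subsets size) (λ S → χ (joins? e i k) * (χ (e ∈? S) * (w S * _)))
          ≈⟨ Σ-cong (subsets size) (λ S → trans (*-congˡ (x∙yz≈y∙xz _ _ _)) (x∙yz≈y∙xz _ _ _)) ⟩
        sumOver (subsets size) (λ S → w S * term S k e) ∎

      collect : ∀ S → w S * rooted S i j + ∑[ k < n ] ∑[ e < size ] (w S * term S k e) ≈
                      I i j * (w S * sumOver (subsets n) (forest S))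
      collect S = begin
        w S * rooted S i j + ∑[ k < n ] ∑[ e < size ] (w S * term S k e)
          ≈⟨ +-congˡ (trans (*-distribˡ-sum {n} (w S) _)
                            (sum-cong-≋ {n} λ k → *-distribˡ-sum {size} (w S) (term S k))) ⟨
        w S * rooted S i j + w S * ∑[ k < n ] ∑[ e < size ] term S k e
          ≈⟨ distribˡ _ _ _ ⟨
        w S * (rooted S i j + ∑[ k < n ] ∑[ e < size ] term S k e)
          ≈⟨ *-congˡ (rooted-balance S i j) ⟩
        w S * (I i j * sumOver (subsets n) (forest S))
          ≈⟨ x∙yz≈y∙xz _ _ _ ⟩
        I i j * (w S * sumOver (subsets n) (forest S)) ∎

    -- The Laplacian as a sum of differences along edges.

    between : Fin n → Fin n → Carrier
    between = totalWeightBetween G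

    between-sym : ∀ i j → between i j ≈ between j i
    between-sym i j = sum-cong-≋ {size} λ e → reflexive (≡.cong (if_then weight e else 0#)
      (does-⇔ (mk⇔ joins-sym joins-sym) (joins? e i j) (joins? e j i)))

    laplacian-sym : Symmetric (laplacian G)
    laplacian-sym i j with i ≟ j | j ≟ i
    ... | yes ≡.refl | yes _   = refl
    ... | yes i≡j    | no  j≢i = contradiction (≡.sym i≡j) j≢i
    ... | no  i≢j    | yes j≡i = contradiction (≡.sym j≡i) i≢j
    ... | no  _      | no  _   = -‿cong (between-sym i j)

    private
      offDiagonal : Matrix n
      offDiagonal i k = if does (i ≟ k) then 0# else - between i k

    -- Writing the diagonal as a multiple of the identity row lets `sum-δˡ` evaluate its
    -- contribution to a product.
    laplacian≈ : ∀ i k → laplacian G i k ≈ offDiagonal i k + I i k * - (∑[ l < n ] offDiagonal i l)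
    laplacian≈ i k with does (i ≟ k)
    ... | true  = sym (trans (+-identityˡ _) (*-identityˡ _))
    ... | false = sym (trans (+-congˡ (zeroˡ _)) (+-identityʳ _))

    -- The diagonal entry is minus the sum of the rest of its row, so each other entry ends up
    -- multiplying a difference of values of `p`.
    laplacian-apply : ∀ i (p : Fin n → Carrier) →
      ∑[ k < n ] (laplacian G i k * p k) ≈
      ∑[ k < n ] ∑[ e < size ] (χ (joins? e i k) * (weight e * (p i - p k)))
    laplacian-apply i p = begin
      ∑[ k < n ] (laplacian G i k * p k)
        ≈⟨ sum-cong-≋ {n} (λ k → trans (*-congʳ (laplacian≈ i k))
             (trans (distribʳ _ _ _) (+-congˡ (*-assoc _ _ _)))) ⟩
      ∑[ k < n ] (offDiagonal i k * p k + I i k * (- D * p k))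
        ≈⟨ trans (∑-distrib-+ {n} _ _) (+-congˡ (sum-δˡ i (λ k → - D * p k))) ⟩
      ∑[ k < n ] (offDiagonal i k * p k) + - D * p i
        ≈⟨ +-congˡ (trans (sym (-‿distribˡ-* _ _)) (-‿cong (*-distribʳ-sum {n} (p i) _))) ⟩
      ∑[ k < n ] (offDiagonal i k * p k) - ∑[ k < n ] (offDiagonal i k * p i)
        ≈⟨ trans (sum-cong-≋ {n} λ k → *-distribˡ-minus _ _ _) (sum-minus {n} _ _) ⟨
      ∑[ k < n ] (offDiagonal i k * (p k - p i))
        ≈⟨ sum-cong-≋ {n} (λ k → edges k (i ≟ k)) ⟩
      ∑[ k < n ] ∑[ e < size ] (χ (joins? e i k) * (weight e * (p i - p k))) ∎
      where
      D : Carrier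
      D = ∑[ l < n ] offDiagonal i l

      between-edges : ∀ k x → between i k * x ≈ ∑[ e < size ] (χ (joins? e i k) * (weight e * x))
      between-edges k x = trans (*-distribʳ-sum {size} x _) (sum-cong-≋ {size} λ e → indicator (joins? e i k))
        where
        indicator : ∀ {P : Set} (d : Dec P) {y} → (if does d then y else 0#) * x ≈ χ d * (y * x)
        indicator (yes _) = sym (*-identityˡ _)
        indicator (no _)  = trans (zeroˡ _) (sym (zeroˡ _))

      edges : ∀ k (d : Dec (i ≡ k)) → (if does d then 0# else - between i k) * (p k - p i) ≈
              ∑[ e < size ] (χ (joins? e i k) * (weight e * (p i - p k)))
      -- For `k = i` the left side is zero by its factor `0#`, and the right side because
      -- `p i - p i` is.
      edges k (yes ≡.refl) = trans (zeroˡ _)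
        (trans (sym (zeroʳ _)) (trans (*-congˡ (sym (-‿inverseʳ (p i)))) (between-edges k (p i - p k))))
      edges k (no _) = trans (neg-swap _ _ _) (between-edges k (p i - p k))
        where
        neg-swap : ∀ x y z → - x * (y - z) ≈ x * (z - y)
        neg-swap x y z = begin
          - x * (y - z)    ≈⟨ -‿distribˡ-* x (y - z) ⟨
          - (x * (y - z))  ≈⟨ -‿distribʳ-* x (y - z) ⟩
          x * - (y - z)    ≈⟨ *-congˡ (-‿+-comm y (- z)) ⟨
          x * (- y - - z)  ≈⟨ *-congˡ (+-congˡ (-‿involutive z)) ⟩
          x * (- y + z)    ≈⟨ *-congˡ (+-comm _ _) ⟩
          x * (z - y)      ∎

    -- The inverse of the identity plus the Laplacian.

    I+L : Matrix n
    I+L i j = I i j + laplacian G i j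

    I+L⊗treeWeight : ∀ i j → (I+L ⊗ treeWeight) i j ≈ I i j * totalForestWeight G
    I+L⊗treeWeight i j = begin
      ∑[ k < n ] ((I i k + laplacian G i k) * treeWeight k j)
        ≈⟨ trans (sum-cong-≋ {n} λ k → distribʳ _ _ _) (∑-distrib-+ {n} _ _) ⟩
      ∑[ k < n ] (I i k * treeWeight k j) + ∑[ k < n ] (laplacian G i k * treeWeight k j)
        ≈⟨ +-cong (sum-δˡ i _) (laplacian-apply i (λ k → treeWeight k j)) ⟩
      treeWeight i j + _
        ≈⟨ treeWeight-balance i j ⟩
      I i j * totalForestWeight G ∎

    private
      f⁻¹ : Carrier
      f⁻¹ = inverse (totalForestWeight G) (totalForestWeight-pos G)

    accessibility : Matrix n
    accessibility i j = treeWeight i j * f⁻¹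

    -- Both matrices are symmetric, so the product in one order settles the other.
    accessibility-isInverse : accessibility IsInverseOf I+L
    accessibility-isInverse = symmetric-rightInverse
      (λ i j → +-cong (I-sym i j) (laplacian-sym i j))
      (λ i j → *-congʳ (treeWeight-sym i j))
      λ i j → begin
        ∑[ k < n ] (I+L i k * (treeWeight k j * f⁻¹))   ≈⟨ sum-cong-≋ {n} (λ k → *-assoc _ _ _) ⟨
        ∑[ k < n ] (I+L i k * treeWeight k j * f⁻¹)     ≈⟨ *-distribʳ-sum {n} f⁻¹ _ ⟨
        (I+L ⊗ treeWeight) i j * f⁻¹                    ≈⟨ *-congʳ (I+L⊗treeWeight i j) ⟩
        I i j * totalForestWeight G * f⁻¹               ≈⟨ *-assoc _ _ _ ⟩
        I i j * (totalForestWeight G * f⁻¹)             ≈⟨ *-congˡ (inverse-inverseʳ _ (totalForestWeight-pos G)) ⟩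
        I i j * 1#                                      ≈⟨ *-identityʳ _ ⟩
        I i j                                           ∎

    -- Unsuccessful connections and their probability.

    unsuccessfulWeight : Fin n → Fin n → Carrier
    unsuccessfulWeight i j =
      sumOver spanningRootedForests λ F → χ (unsuccessfulConnection? i j F) * ε G F

    -- The forests with root `i` split according to whether `j` lies in the tree of `i`; those in
    -- which it does have total weight `treeWeight j i`.
    unsuccessfulWeight≈ : ∀ i j → unsuccessfulWeight i j ≈ treeWeight i i - treeWeight j i
    unsuccessfulWeight≈ i j = +-cancel (begin
      unsuccessfulWeight i j + treeWeight j i
        ≈⟨ +-congʳ (Σ-forests _) ⟩
      sumOver (subsets size) (λ S → sumOver (subsets n) (λ R →
        forest S R * (χ (unsuccessfulConnection? i j (S , R)) * w S))) + treeWeight j i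
        ≈⟨ Σ-distrib-+ (subsets size) _ _ ⟨
      sumOver (subsets size) (λ S → sumOver (subsets n) (λ R →
        forest S R * (χ (unsuccessfulConnection? i j (S , R)) * w S)) + w S * rooted S j i)
        ≈⟨ Σ-cong (subsets size) perEdgeSet ⟩
      treeWeight i i ∎)
      where
      perRootSet : ∀ S R →
        forest S R * (χ (unsuccessfulConnection? i j (S , R)) * w S) +
        w S * (conn S j i * (χ (i ∈? R) * forest S R)) ≈
        w S * (conn S i i * (χ (i ∈? R) * forest S R))
      perRootSet S R = begin
        forest S R * (χ (unsuccessfulConnection? i j (S , R)) * w S) +
        w S * (conn S j i * (χ (i ∈? R) * forest S R))
          ≈⟨ +-cong
               (trans (x∙yz≈z∙yx _ _ _) (*-congˡ
                 (trans (*-congʳ (trans (χ-× (i ∈? R) (¬? (connected? S i j))) (*-comm _ _))) (*-assoc _ _ _))))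
               (*-congˡ (*-congʳ (conn-sym S j i))) ⟩
        w S * (χ (¬? (connected? S i j)) * (χ (i ∈? R) * forest S R)) +
        w S * (conn S i j * (χ (i ∈? R) * forest S R))
          ≈⟨ trans (*-congˡ (distribʳ _ _ _)) (distribˡ _ _ _) ⟨
        w S * ((χ (¬? (connected? S i j)) + conn S i j) * (χ (i ∈? R) * forest S R))
          -- The complementary indicators add up to `1#`, which is also the value of `conn S i i`.
          ≈⟨ *-congˡ (*-congʳ (trans (χ-¬ (connected? S i j))
               (sym (χ-yes (connected? S i i) connected-refl)))) ⟩
        w S * (conn S i i * (χ (i ∈? R) * forest S R)) ∎

      perEdgeSet : ∀ S →
        sumOver (subsets n) (λ R → forest S R * (χ (unsuccessfulConnection? i j (S , R)) * w S)) +
        w S * rooted S j i ≈ w S * rooted S i i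
      perEdgeSet S = begin
        sumOver (subsets n) (λ R → forest S R * (χ (unsuccessfulConnection? i j (S , R)) * w S)) +
        w S * rooted S j i
          ≈⟨ +-congˡ (*-distribˡ-Σ (w S) (subsets n) _) ⟩
        sumOver (subsets n) (λ R → forest S R * (χ (unsuccessfulConnection? i j (S , R)) * w S)) +
        sumOver (subsets n) (λ R → w S * (conn S j i * (χ (i ∈? R) * forest S R)))
          ≈⟨ Σ-distrib-+ (subsets n) _ _ ⟨
        sumOver (subsets n) (λ R → forest S R * (χ (unsuccessfulConnection? i j (S , R)) * w S) +
                                   w S * (conn S j i * (χ (i ∈? R) * forest S R)))
          ≈⟨ Σ-cong (subsets n) (perRootSet S) ⟩
        sumOver (subsets n) (λ R → w S * (conn S i i * (χ (i ∈? R) * forest S R)))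
          ≈⟨ *-distribˡ-Σ (w S) (subsets n) _ ⟨
        w S * rooted S i i ∎

    probability≈ : ∀ i j → probabilityUnsuccessful G i j ≈
                   ½ * (unsuccessfulWeight i j * f⁻¹ + unsuccessfulWeight j i * f⁻¹)
    probability≈ i j = begin
      probabilityUnsuccessful G i j
        ≈⟨ Σ-filter (unsuccessfulBetween? G i j) (cartesianProduct choices spanningRootedForests) _ ⟩
      sumOver (cartesianProduct choices spanningRootedForests) _
        ≈⟨ Σ-cartesianProduct choices spanningRootedForests _ ⟩
      half i j + (half j i + 0#)
        ≈⟨ +-cong (half≈ i j) (trans (+-identityʳ _) (half≈ j i)) ⟩
      ½ * (unsuccessfulWeight i j * f⁻¹) + ½ * (unsuccessfulWeight j i * f⁻¹)
        ≈⟨ distribˡ _ _ _ ⟨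
      ½ * (unsuccessfulWeight i j * f⁻¹ + unsuccessfulWeight j i * f⁻¹) ∎
      where
      choices : List Choice
      choices = first ∷ second ∷ []

      half : Fin n → Fin n → Carrier
      half i j = sumOver spanningRootedForests λ F →
        χ (unsuccessfulConnection? i j F) * (½ * (ε G F * f⁻¹))

      half≈ : ∀ i j → half i j ≈ ½ * (unsuccessfulWeight i j * f⁻¹)
      half≈ i j = begin
        half i j
          ≈⟨ Σ-cong spanningRootedForests (λ F → trans (x∙yz≈y∙xz _ _ _)
               (*-congˡ (trans (sym (*-assoc _ _ _)) (*-comm _ _)))) ⟩
        sumOver spanningRootedForests (λ F → ½ * (f⁻¹ * (χ (unsuccessfulConnection? i j F) * ε G F)))
          ≈⟨ trans (*-congˡ (*-distribˡ-Σ f⁻¹ spanningRootedForests _))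
                   (*-distribˡ-Σ ½ spanningRootedForests _) ⟨
        ½ * (f⁻¹ * unsuccessfulWeight i j)
          ≈⟨ *-congˡ (*-comm _ _) ⟩
        ½ * (unsuccessfulWeight i j * f⁻¹) ∎

    forestDistance≈ : ∀ i j → forestDistance accessibility i j ≈ probabilityUnsuccessful G i j
    forestDistance≈ i j = begin
      ½ * (q i i + q j j - q i j - q j i)
        -- `q i i` is paired with `q j i`, in which `i` is again the root, to match
        -- `unsuccessfulWeight≈`.
        ≈⟨ *-congˡ (rearrange _ _ _ _) ⟩
      ½ * ((q i i - q j i) + (q j j - q i j))
        ≈⟨ *-congˡ (+-cong (difference i j) (difference j i)) ⟩
      ½ * (unsuccessfulWeight i j * f⁻¹ + unsuccessfulWeight j i * f⁻¹)
        ≈⟨ probability≈ i j ⟨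
      probabilityUnsuccessful G i j ∎
      where
      q : Matrix n
      q = accessibility

      difference : ∀ i j → q i i - q j i ≈ unsuccessfulWeight i j * f⁻¹
      difference i j = trans (sym (*-distribʳ-minus _ _ _)) (*-congʳ (sym (unsuccessfulWeight≈ i j)))

      rearrange : ∀ a b c d → a + b - c - d ≈ (a - d) + (b - c)
      rearrange a b c d = begin
        a + b - c - d        ≈⟨ +-assoc _ _ _ ⟩
        a + b + (- c - d)    ≈⟨ +-congˡ (+-comm _ _) ⟩
        a + b + (- d - c)    ≈⟨ +-interchange _ _ _ _ ⟩
        (a - d) + (b - c)    ∎

  -- Scaling the weights

  laplacian-scale : ∀ {n} α (0<α : 0# < α) (G : WeightedMultigraph n) i j →
                    α * laplacian G i j ≈ laplacian (scale α 0<α G) i j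
  laplacian-scale {n} α 0<α G i j =
    *-if (does (i ≟ j))
      (*-neg (trans (*-distribˡ-sum {n} α _)
                    (sum-cong-≋ {n} λ k → *-if (does (i ≟ k)) (zeroʳ α) (*-neg (between-scale k)))))
      (*-neg (between-scale j))
    where
    open WeightedMultigraph G

    *-neg : ∀ {x y} → α * x ≈ y → α * - x ≈ - y
    *-neg αx≈y = trans (sym (-‿distribʳ-* α _)) (-‿cong αx≈y)

    *-if : ∀ b {x y x′ y′} → α * x ≈ x′ → α * y ≈ y′ →
           α * (if b then x else y) ≈ (if b then x′ else y′)
    *-if true  αx≈x′ _     = αx≈x′
    *-if false _     αy≈y′ = αy≈y′

    between-scale : ∀ k → α * totalWeightBetween G i k ≈ totalWeightBetween (scale α 0<α G) i k
    between-scale k = trans (*-distribˡ-sum {size} α _)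
      (sum-cong-≋ {size} λ e → *-if (does (joins? e i k)) refl (zeroʳ α))

-- The forest distance as a probability.

proposition10 : ∀ {c ℓ₁ ℓ₂ ℓ₃} (K : OrderedField c ℓ₁ ℓ₂ ℓ₃) →
    let open OrderedField K
        open ForestDistance K
    in
    (α : Carrier) (0<α : 0# < α) (n : ℕ) (G : WeightedMultigraph n) (i j : Fin n) →
    (∃ λ Q → IsForestAccessibilityMatrix G α Q) ×
    (∀ Q → IsForestAccessibilityMatrix G α Q →
           forestDistance Q i j ≈ probabilityUnsuccessful (scale α 0<α G) i j)
-- The tree weights of the scaled graph supply an explicit inverse. Inverses being unique, any `Q`
-- agrees with it entrywise, which reduces the claim to `forestDistance≈`.
proposition10 K α 0<α n G i j = (accessibility , right , left) , λ Q (_ , QW≋I) →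
  let Q≋ = leftInverse≋rightInverse QW≋I right in
  trans (*-congˡ (+-cong (+-cong (+-cong (Q≋ i i) (Q≋ j j)) (-‿cong (Q≋ i j))) (-‿cong (Q≋ j i))))
        (forestDistance≈ i j)
  where
  open OrderedField K
  open ForestDistance K
  open MatrixForest K
  open Accessibility (scale α 0<α G)

  W : Matrix n
  W i j = I i j + α * laplacian G i j

  W≋I+L : W ≋ I+L
  W≋I+L i j = +-congˡ (laplacian-scale α 0<α G i j)

  right : W ⊗ accessibility ≋ I
  right i j = trans (⊗-cong {B = accessibility} W≋I+L (λ _ _ → refl) i j) (proj₁ accessibility-isInverse i j)

  left : accessibility ⊗ W ≋ I
  left i j = trans (⊗-cong {A = accessibility} (λ _ _ → refl) W≋I+L i j) (proj₂ accessibility-isInverse i j)
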